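{- Let $l\in\{1,2,3\}$ and let $k\geq l$ be an integer. Let $T$ be a doubly regular tournament of order $4k+3$. Then every tournament obtained from $T$ by removing $l$ vertices has simplicity index exactly $(2k+1)-l$.
   Context: A tournament $T=(V,A)$ consists of a finite vertex set $V$ and a set $A$ of ordered pairs of distinct vertices (arcs) such that for all $x\neq y\in V$, $(x,y)\in A$ if and only if $(y,x)\notin A$. One writes $x\rightarrow y$ ($x$ dominates $y$) when $(x,y)\in A$. The order of a tournament is its number of vertices. A tournament is doubly regular if there is an integer $m\geq 1$ such that for every unordered pair $\{x,y\}$ of distinct vertices there are exactly $m$ vertices $z$ with $x\rightarrow z$ and $y\rightarrow z$. Removing vertices from $T$ means taking the subtournament induced by the remaining vertices. A module of $T$ is a subset $M\subseteq V$ such that for every $x\in V\setminus M$, either $m\rightarrow x$ for all $m\in M$, or $x\rightarrow m$ for all $m\in M$. The trivial modules are $\emptyset$, the singletons and $V$. A tournament with $n$ vertices is simple if $n\geq 3$ and all its modules are trivial. For a tournament $T$ with at least $3$ vertices, the simplicity index $s(T)$ is the minimum number of arcs of $T$ whose reversal yields a non-simple tournament (so $s(T)=0$ if $T$ is not simple). -}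

module Defs where

open import Algebra.Properties.CommutativeMonoid.Sum using (sum)
open import Data.Empty using (⊥-elim)
open import Data.Fin.Base using (Fin; zero; suc)
open import Data.Fin.Properties using (suc-injective)
open import Data.Fin.Subset
open import Data.Fin.Subset.Properties
  using (_∈?_; x∈p∪q⁺; x∈p∪q⁻; p─q⊆p; x∈p∧x∉q⇒x∈p─q)
open import Data.Nat.Base using (ℕ; _≤_)
open import Data.Nat.Properties using (+-0-commutativeMonoid)
open import Data.Product.Base using (∃; _×_; _,_)
open import Data.Sum.Base using (_⊎_; inj₁; inj₂)
open import Data.Vec.Base using (_∷_; there; lookup; tabulate)
open import Data.Vec.Properties
  using ([]=⇒lookup; lookup⇒[]=; lookup∘tabulate)
open import Function.Base using (_∘_)
open import Function.Bundles using (_⇔_; mk⇔; module Equivalence)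
open import Relation.Binary.PropositionalEquality
  using (_≡_; _≢_; refl; sym; trans; cong)
open import Relation.Nullary using (¬_; yes; no)

private
  variable
    n : ℕ

-- A set P of ordered pairs of vertices, stored row by row:
-- (x , y) belongs to P when y ∈ P x.
PairSet : ℕ → Set
PairSet n = Fin n → Subset n

infix 4 _⊆ᴾ_

_⊆ᴾ_ : PairSet n → PairSet n → Set
P ⊆ᴾ Q = ∀ x → P x ⊆ Q x

size : PairSet n → ℕ
size P = sum +-0-commutativeMonoid (λ x → ∣ P x ∣)

converse : PairSet n → PairSet n
converse P x = tabulate (λ y → lookup (P y) x)

-- The vertex set of a tournament of order n is Fin n.
record Tournament (n : ℕ) : Set where
  field
    arcs     : PairSet n
    distinct : ∀ x → x ∉ arcs x
    oriented : ∀ {x y} → x ≢ y → (y ∈ arcs x) ⇔ (x ∉ arcs y)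

  infix 4 _⟶_

  _⟶_ : Fin n → Fin n → Set
  x ⟶ y = y ∈ arcs x

open Tournament using (arcs)

DoublyRegular : Tournament n → Set
DoublyRegular T =
  ∃ λ m → 1 ≤ m × (∀ x y → x ≢ y → ∣ arcs T x ∩ arcs T y ∣ ≡ m)

IsModule : Tournament n → Subset n → Set
IsModule T M = ∀ x → x ∉ M → (∀ m → m ∈ M → m ⟶ x) ⊎ (∀ m → m ∈ M → x ⟶ m)
  where open Tournament T

IsTrivial : Subset n → Set
IsTrivial M = M ≡ ⊥ ⊎ (∃ λ x → M ≡ ⁅ x ⁆) ⊎ M ≡ ⊤

IsSimple : Tournament n → Set
IsSimple {n} T = 3 ≤ n × (∀ M → IsModule T M → IsTrivial M)

-- The increasing enumeration of the elements of S.
element : (S : Subset n) → Fin ∣ S ∣ → Fin n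
element (inside  ∷ S) zero    = zero
element (inside  ∷ S) (suc i) = suc (element S i)
element (outside ∷ S) i       = suc (element S i)

element-injective : (S : Subset n) {i j : Fin ∣ S ∣} →
                    element S i ≡ element S j → i ≡ j
element-injective (inside  ∷ S) {zero}  {zero}  _  = refl
element-injective (inside  ∷ S) {suc i} {suc j} eq =
  cong suc (element-injective S (suc-injective eq))
element-injective (outside ∷ S) eq = element-injective S (suc-injective eq)

∈-tabulate⁺ : {f : Fin n → Side} {x : Fin n} → f x ≡ inside → x ∈ tabulate f
∈-tabulate⁺ {f = f} {x} eq = lookup⇒[]= x _ (trans (lookup∘tabulate f x) eq)

∈-tabulate⁻ : {f : Fin n → Side} {x : Fin n} → x ∈ tabulate f → f x ≡ inside
∈-tabulate⁻ {f = f} {x} x∈ =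
  trans (sym (lookup∘tabulate f x)) ([]=⇒lookup x∈)

∈-converse⁺ : (P : PairSet n) {x y : Fin n} → x ∈ P y → y ∈ converse P x
∈-converse⁺ P x∈ = ∈-tabulate⁺ ([]=⇒lookup x∈)

∈-converse⁻ : (P : PairSet n) {x y : Fin n} → y ∈ converse P x → x ∈ P y
∈-converse⁻ P {x} {y} y∈ =
  lookup⇒[]= x (P y) (∈-tabulate⁻ {f = λ z → lookup (P z) x} y∈)

x∈p─q⇒x∉q : (p q : Subset n) {x : Fin n} → x ∈ p ─ q → x ∉ q
x∈p─q⇒x∉q (_ ∷ p) (inside  ∷ q) (there x∈) (there x∈q) = x∈p─q⇒x∉q p q x∈ x∈q
x∈p─q⇒x∉q (_ ∷ p) (outside ∷ q) (there x∈) (there x∈q) = x∈p─q⇒x∉q p q x∈ x∈q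

-- The subtournament induced by S, its vertices relabelled by Fin ∣ S ∣.
induced : Tournament n → (S : Subset n) → Tournament ∣ S ∣
induced {n} T S = record
  { arcs     = arcs′
  ; distinct = λ i → distinct (element S i) ∘ out⁻
  ; oriented = λ i≢j →
      let open Equivalence (oriented (i≢j ∘ element-injective S)) in
      mk⇔ (λ j∈ i∈ → to (out⁻ j∈) (out⁻ i∈))
          (λ i∉ → out⁺ (from (i∉ ∘ out⁺)))
  }
  where
  open Tournament T hiding (arcs)

  arcs′ : PairSet ∣ S ∣
  arcs′ i = tabulate (λ j → lookup (arcs T (element S i)) (element S j))

  out⁺ : ∀ {i j} → element S i ⟶ element S j → j ∈ arcs′ i
  out⁺ = ∈-tabulate⁺ ∘ []=⇒lookup

  out⁻ : ∀ {i j} → j ∈ arcs′ i → element S i ⟶ element S j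
  out⁻ {i} {j} j∈ = lookup⇒[]= (element S j) _
    (∈-tabulate⁻ {f = λ j → lookup (arcs T (element S i)) (element S j)} j∈)

remove : Tournament n → (R : Subset n) → Tournament ∣ ∁ R ∣
remove T R = induced T (∁ R)

reverse : (T : Tournament n) (B : PairSet n) → B ⊆ᴾ arcs T → Tournament n
reverse {n} T B B⊆A = record
  { arcs     = arcs′
  ; distinct = irr
  ; oriented = λ x≢y → mk⇔ (asym x≢y) (conn x≢y)
  }
  where
  open Tournament T hiding (arcs)

  arcs′ : PairSet n
  arcs′ x = (arcs T x ─ B x) ∪ converse B x

  kept : ∀ {x y} → x ⟶ y → y ∉ B x → y ∈ arcs′ x
  kept y∈A y∉B = x∈p∪q⁺ (inj₁ (x∈p∧x∉q⇒x∈p─q y∈A y∉B))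

  reversed : ∀ {x y} → x ∈ B y → y ∈ arcs′ x
  reversed x∈B = x∈p∪q⁺ (inj₂ (∈-converse⁺ B x∈B))

  origin : ∀ {x y} → y ∈ arcs′ x → (x ⟶ y × y ∉ B x) ⊎ x ∈ B y
  origin {x} {y} y∈ with x∈p∪q⁻ (arcs T x ─ B x) (converse B x) y∈
  ... | inj₁ y∈─ = inj₁ (p─q⊆p (arcs T x) (B x) y∈─ , x∈p─q⇒x∉q (arcs T x) (B x) y∈─)
  ... | inj₂ y∈c = inj₂ (∈-converse⁻ B y∈c)

  irr : ∀ x → x ∉ arcs′ x
  irr x x∈ with origin x∈
  ... | inj₁ (x⟶x , _) = distinct x x⟶x
  ... | inj₂ x∈B       = distinct x (B⊆A x x∈B)

  asym : ∀ {x y} → x ≢ y → y ∈ arcs′ x → x ∉ arcs′ y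
  asym {x} {y} x≢y y∈ x∈ with origin y∈ | origin x∈
  ... | inj₁ (x⟶y , _) | inj₁ (y⟶x , _) = Equivalence.to (oriented x≢y) x⟶y y⟶x
  ... | inj₁ (_ , y∉B) | inj₂ y∈B       = y∉B y∈B
  ... | inj₂ x∈B       | inj₁ (_ , x∉B) = x∉B x∈B
  ... | inj₂ x∈B       | inj₂ y∈B       =
    Equivalence.to (oriented x≢y) (B⊆A x y∈B) (B⊆A y x∈B)

  conn : ∀ {x y} → x ≢ y → x ∉ arcs′ y → y ∈ arcs′ x
  conn {x} {y} x≢y x∉ with x ∈? arcs T y | y ∈? B x | x ∈? B y
  ... | _       | yes y∈B | _       = ⊥-elim (x∉ (reversed y∈B))
  ... | _       | no _    | yes x∈B = reversed x∈B
  ... | yes y⟶x | no _    | no x∉B  = ⊥-elim (x∉ (kept y⟶x x∉B))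
  ... | no ¬y⟶x | no y∉B  | no _    =
    kept (Equivalence.from (oriented x≢y) ¬y⟶x) y∉B

-- s is the simplicity index of T: the minimum of size B over the sets B of
-- arcs of T whose reversal is not simple.  Defined only for order at least 3.
record IsSimplicityIndex {n : ℕ} (T : Tournament n) (s : ℕ) : Set where
  field
    order≥3  : 3 ≤ n
    attained : ∃ λ B → ∃ λ (B⊆A : B ⊆ᴾ arcs T) →
               size B ≡ s × ¬ IsSimple (reverse T B B⊆A)
    minimal  : ∀ B (B⊆A : B ⊆ᴾ arcs T) →
               ¬ IsSimple (reverse T B B⊆A) → s ≤ size B

{-# OPTIONS --safe #-}

-- Count, in the doubly regular tournament T, the arcs that must be reversed to
-- turn M into a module of T − R.  A vertex x outside M and R with a out- and b
-- in-neighbours in M costs min(a , b).  If few vertices Q lie outside M and R,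
-- then both a and b are at least 2k + 1 − |R| − (|Q| − 1) and Q is charged
-- directly.  Otherwise |M| ≤ 2k + 1; as any two vertices have k common
-- out-neighbours, the first and second moments of b over all vertices are
-- known, so ∑ b (|M| − b) is known too, and bounding its terms on M and on R
-- leaves enough for Q, where a b ≤ (|M| − 1) min(a , b).
--
-- Conversely, a vertex dominating R or dominated by R becomes a source or a sink
-- of T − R, and two vertices separated by every element of R become twins, after
-- the reversal of 2k + 1 − |R| arcs; for |R| ≤ 3 such vertices exist.
module Submission where

open import Defs
import Algebra.Properties.Semiring.Sum as SemiringSum
open import Data.Bool.Base using (Bool; true; false; not; _∧_; if_then_else_)
open import Data.Fin.Base using (Fin; zero; suc)
open import Data.Fin.Properties using (_≟_)
open import Data.Fin.Subset
  using (Subset; inside; outside; ∣_∣; _∈_; _∉_; ∁; _∩_; _∪_; ⁅_⁆; ⊥; ⊤)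
open import Data.Fin.Subset.Properties
  using (_∈?_; ∉⊥; ∈⊤; x∈⁅x⁆; x∈⁅y⁆⇒x≡y; x∉p⇒x∈∁p; x∈∁p⇒x∉p; x∈p⇒x∉∁p;
         x∈p∪q⁺; x∈p∪q⁻; x∈p∩q⁺; x∈p∩q⁻; p∩q⊆p; x∈p∧x∉q⇒x∈p─q;
         ∣p∣≡n⇒p≡⊤; ∣⊥∣≡0; ∣⊤∣≡n; ∣⁅x⁆∣≡1; ∣∁p∣≡n∸∣p∣)
open import Data.Nat.Base
  using (ℕ; zero; suc; _+_; _*_; _∸_; _⊓_; _≤_; _<_; z≤n; s≤s; s≤s⁻¹; z<s; >-nonZero)
open import Data.Nat.Properties hiding (_≟_)
open import Data.Nat.Tactic.RingSolver using (solve-∀)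
open import Data.Product.Base using (∃; _×_; _,_; proj₁; proj₂)
open import Data.Sum.Base using (_⊎_; inj₁; inj₂; [_,_]′)
open import Data.Vec.Base using ([]; _∷_; lookup; here; there)
open import Data.Vec.Properties
  using ([]=⇒lookup; lookup⇒[]=; lookup∘tabulate; lookup-zipWith; lookup-map; lookup-replicate)
open import Function.Base using (_∘_)
open import Function.Bundles using (module Equivalence)
open import Relation.Binary.PropositionalEquality
  using (_≡_; _≢_; refl; sym; trans; cong; cong₂; subst)
open import Relation.Nullary using (¬_; Dec; yes; no; contradiction)

open Tournament using (arcs)

private
  variable
    n : ℕ

-- Indicator sums

⟦_⟧ : Bool → ℕ
⟦ true  ⟧ = 1
⟦ false ⟧ = 0

χ : Subset n → Fin n → ℕ
χ S x = ⟦ lookup S x ⟧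

private module ℕ-Sum = SemiringSum +-*-semiring

-- Opaque, so that the number of summands can be inferred by unification.
opaque
  sum : (Fin n → ℕ) → ℕ
  sum = ℕ-Sum.sum

  sum-size : (P : PairSet n) → size P ≡ sum (λ x → ∣ P x ∣)
  sum-size P = refl

  sum-cong : {f g : Fin n → ℕ} → (∀ x → f x ≡ g x) → sum f ≡ sum g
  sum-cong = ℕ-Sum.sum-cong-≗

  sum-+ : (f g : Fin n → ℕ) → sum (λ x → f x + g x) ≡ sum f + sum g
  sum-+ = ℕ-Sum.∑-distrib-+

  sum-comm : ∀ {m n} (f : Fin m → Fin n → ℕ) →
             sum (λ x → sum (λ y → f x y)) ≡ sum (λ y → sum (λ x → f x y))
  sum-comm = ℕ-Sum.∑-comm

  sum-*ˡ : ∀ c (f : Fin n → ℕ) → c * sum f ≡ sum (λ x → c * f x)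
  sum-*ˡ = ℕ-Sum.*-distribˡ-sum

  sum-*ʳ : ∀ c (f : Fin n → ℕ) → sum f * c ≡ sum (λ x → f x * c)
  sum-*ʳ = ℕ-Sum.*-distribʳ-sum

  sum-mono : {f g : Fin n → ℕ} → (∀ i → f i ≤ g i) → sum f ≤ sum g
  sum-mono {zero}  f≤g = z≤n
  sum-mono {suc n} f≤g = +-mono-≤ (f≤g zero) (sum-mono (f≤g ∘ suc))

  sum-<⇒∃< : (f g : Fin n → ℕ) → sum f < sum g → ∃ λ x → f x < g x
  sum-<⇒∃< {suc n} f g lt with f zero <? g zero
  ... | yes f₀<g₀ = zero , f₀<g₀
  ... | no  f₀≮g₀ = let x , p = sum-<⇒∃< (f ∘ suc) (g ∘ suc) tail< in suc x , p
    where
    tail< : sum (f ∘ suc) < sum (g ∘ suc)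
    tail< = +-cancelˡ-< (f zero) _ _
      (<-≤-trans lt (+-monoˡ-≤ (sum (g ∘ suc)) (≮⇒≥ f₀≮g₀)))

  sum-const : ∀ n c → sum {n} (λ _ → c) ≡ n * c
  sum-const zero    c = refl
  sum-const (suc n) c = cong (c +_) (sum-const n c)

  sum-χ : (S : Subset n) → sum (χ S) ≡ ∣ S ∣
  sum-χ []            = refl
  sum-χ (inside  ∷ S) = cong suc (sum-χ S)
  sum-χ (outside ∷ S) = sum-χ S

sum-zero : {f : Fin n → ℕ} → (∀ x → f x ≡ 0) → sum f ≡ 0
sum-zero {n} f≡0 = trans (sum-cong f≡0) (trans (sum-const n 0) (*-zeroʳ n))

χ-∈ : {S : Subset n} {x : Fin n} → x ∈ S → χ S x ≡ 1
χ-∈ x∈S = cong ⟦_⟧ ([]=⇒lookup x∈S)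

χ-∉ : (S : Subset n) {x : Fin n} → x ∉ S → χ S x ≡ 0
χ-∉ S {x} x∉S with lookup S x in eq
... | true  = contradiction (lookup⇒[]= x S eq) x∉S
... | false = refl

χ-<⇒∈ : (S : Subset n) {x : Fin n} → 0 < χ S x → x ∈ S
χ-<⇒∈ S {x} lt with lookup S x in eq
χ-<⇒∈ S {x} lt | true  = lookup⇒[]= x S eq
χ-<⇒∈ S {x} () | false

χ-≤1 : (S : Subset n) (x : Fin n) → χ S x ≤ 1
χ-≤1 S x with lookup S x
... | true  = ≤-refl
... | false = z≤n

χ-idem : (S : Subset n) (x : Fin n) → χ S x * χ S x ≡ χ S x
χ-idem S x with lookup S x
... | true  = refl
... | false = refl

χ-∩ : (S U : Subset n) (x : Fin n) → χ (S ∩ U) x ≡ χ S x * χ U x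
χ-∩ S U x rewrite lookup-zipWith _∧_ x S U with lookup S x | lookup U x
... | true  | true  = refl
... | true  | false = refl
... | false | _     = refl

χ-∁ : (S : Subset n) (x : Fin n) → χ (∁ S) x + χ S x ≡ 1
χ-∁ S x rewrite lookup-map x not S with lookup S x
... | true  = refl
... | false = refl

χ-⊥ : (x : Fin n) → χ ⊥ x ≡ 0
χ-⊥ x = cong ⟦_⟧ (lookup-replicate x outside)

δ : Fin n → Fin n → ℕ
δ x = χ ⁅ x ⁆

δ-refl : (x : Fin n) → δ x x ≡ 1
δ-refl x = χ-∈ (x∈⁅x⁆ x)

δ-≢ : {x y : Fin n} → x ≢ y → δ x y ≡ 0
δ-≢ {x = x} x≢y = χ-∉ ⁅ x ⁆ λ y∈ → x≢y (sym (x∈⁅y⁆⇒x≡y x y∈))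

opaque
  unfolding sum

  sum-δ : (x : Fin n) (f : Fin n → ℕ) → sum (λ y → δ x y * f y) ≡ f x
  sum-δ zero    f = trans
    (cong₂ _+_ (*-identityˡ (f zero))
      (sum-zero λ y → cong (_* f (suc y)) (χ-⊥ y)))
    (+-identityʳ (f zero))
  sum-δ (suc x) f = sum-δ x (f ∘ suc)

∣S∣≡0⇒S≡⊥ : (S : Subset n) → ∣ S ∣ ≡ 0 → S ≡ ⊥
∣S∣≡0⇒S≡⊥ []            _  = refl
∣S∣≡0⇒S≡⊥ (outside ∷ S) eq = cong (outside ∷_) (∣S∣≡0⇒S≡⊥ S eq)

∣S∣≡1⇒S≡⁅x⁆ : (S : Subset n) → ∣ S ∣ ≡ 1 → ∃ λ x → S ≡ ⁅ x ⁆
∣S∣≡1⇒S≡⁅x⁆ (inside  ∷ S) eq =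
  zero , cong (inside ∷_) (∣S∣≡0⇒S≡⊥ S (suc-injective eq))
∣S∣≡1⇒S≡⁅x⁆ (outside ∷ S) eq =
  let x , S≡⁅x⁆ = ∣S∣≡1⇒S≡⁅x⁆ S eq in suc x , cong (outside ∷_) S≡⁅x⁆

trivial⇒∣M∣ : {M : Subset n} → IsTrivial M → ∣ M ∣ ≤ 1 ⊎ ∣ M ∣ ≡ n
trivial⇒∣M∣ {n} (inj₁ refl)              = inj₁ (≤-trans (≤-reflexive (∣⊥∣≡0 n)) z≤n)
trivial⇒∣M∣     (inj₂ (inj₁ (x , refl))) = inj₁ (≤-reflexive (∣⁅x⁆∣≡1 x))
trivial⇒∣M∣ {n} (inj₂ (inj₂ refl))       = inj₂ (∣⊤∣≡n n)

-- Vertex sets of induced subtournaments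

element-∈ : (S : Subset n) (i : Fin ∣ S ∣) → element S i ∈ S
element-∈ (inside  ∷ S) zero    = here
element-∈ (inside  ∷ S) (suc i) = there (element-∈ S i)
element-∈ (outside ∷ S) i       = there (element-∈ S i)

element-surjective : (S : Subset n) {x : Fin n} → x ∈ S → ∃ λ i → element S i ≡ x
element-surjective (inside  ∷ S) here       = zero , refl
element-surjective (inside  ∷ S) (there x∈) =
  let i , eq = element-surjective S x∈ in suc i , cong suc eq
element-surjective (outside ∷ S) (there x∈) =
  let i , eq = element-surjective S x∈ in i , cong suc eq

-- Carries a set of relabelled vertices back to the original ones, so that degrees into a module of
-- T - R can be computed in T, where the regularity is known.
extend : (S : Subset n) → Subset ∣ S ∣ → Subset n
extend []            M       = []
extend (inside  ∷ S) (m ∷ M) = m ∷ extend S M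
extend (outside ∷ S) M       = outside ∷ extend S M

extend-partition : (S : Subset n) (M : Subset ∣ S ∣) (x : Fin n) →
                   χ (extend S M) x + χ (extend S (∁ M)) x ≡ χ S x
extend-partition (inside  ∷ S) (true  ∷ M) zero    = refl
extend-partition (inside  ∷ S) (false ∷ M) zero    = refl
extend-partition (inside  ∷ S) (m ∷ M)     (suc x) = extend-partition S M x
extend-partition (outside ∷ S) M           zero    = refl
extend-partition (outside ∷ S) M           (suc x) = extend-partition S M x

opaque
  unfolding sum

  sum-extend : (S : Subset n) (M : Subset ∣ S ∣) (f : Fin n → ℕ) →
               sum (λ x → χ (extend S M) x * f x) ≡ sum (λ i → χ M i * f (element S i))
  sum-extend []            []      f = refl
  sum-extend (inside  ∷ S) (m ∷ M) f = cong (⟦ m ⟧ * f zero +_) (sum-extend S M (f ∘ suc))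
  sum-extend (outside ∷ S) M       f = sum-extend S M (f ∘ suc)

  sum-element : (S : Subset n) (f : Fin n → ℕ) →
                sum (f ∘ element S) ≡ sum (λ x → χ S x * f x)
  sum-element []            f = refl
  sum-element (inside  ∷ S) f =
    cong₂ _+_ (sym (*-identityˡ (f zero))) (sum-element S (f ∘ suc))
  sum-element (outside ∷ S) f = sum-element S (f ∘ suc)

-- Degrees in regular and doubly regular tournaments

-- Degrees of x into a weighted vertex set. Weight and relation are arbitrary because
-- `second-moment` takes the in-degrees themselves as weights and `module-cost` takes the reversed
-- arcs as the relation.
out inn : (Fin n → Fin n → ℕ) → (Fin n → ℕ) → Fin n → ℕ
out α μ x = sum λ y → μ y * α x y
inn α μ x = sum λ y → μ y * α y x

module _ (T : Tournament n) where
  open Tournament T hiding (arcs)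

  adj : Fin n → Fin n → ℕ
  adj x = χ (arcs T x)

  adj-irrefl : ∀ x → adj x x ≡ 0
  adj-irrefl x = χ-∉ (arcs T x) (distinct x)

  adj-total : ∀ x y → adj x y + adj y x + δ x y ≡ 1
  adj-total x y with x ≟ y
  ... | yes refl rewrite adj-irrefl x = δ-refl x
  ... | no x≢y rewrite δ-≢ x≢y with y ∈? arcs T x
  ...   | yes x⟶y rewrite χ-∈ x⟶y | χ-∉ (arcs T y) (Equivalence.to (oriented x≢y) x⟶y) = refl
  ...   | no ¬x⟶y rewrite χ-∉ (arcs T x) ¬x⟶y
                        | χ-∈ (Equivalence.from (oriented (x≢y ∘ sym)) ¬x⟶y) = refl

  degree-total : ∀ μ x → out adj μ x + inn adj μ x + μ x ≡ sum μ
  degree-total μ x = begin-equality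
    out adj μ x + inn adj μ x + μ x
      ≡⟨ cong (out adj μ x + inn adj μ x +_) (sym (sum-δ x μ)) ⟩
    out adj μ x + inn adj μ x + sum (λ y → δ x y * μ y)
      ≡⟨ cong (_+ sum (λ y → δ x y * μ y)) (sym (sum-+ _ _)) ⟩
    sum (λ y → μ y * adj x y + μ y * adj y x) + sum (λ y → δ x y * μ y)
      ≡⟨ sym (sum-+ _ _) ⟩
    sum (λ y → μ y * adj x y + μ y * adj y x + δ x y * μ y)
      ≡⟨ sum-cong (λ y → trans (factor (μ y) _ _ _)
           (trans (cong (μ y *_) (adj-total x y)) (*-identityʳ (μ y)))) ⟩
    sum μ ∎
    where
    open ≤-Reasoning
    factor : ∀ m a b d → m * a + m * b + d * m ≡ m * (a + b + d)
    factor = solve-∀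

-- Both sides sum `ν x * μ y * α x y` over all pairs. This double count moves a charge from one end
-- of an arc to the other.
sum-out≡sum-inn : ∀ (α : Fin n → Fin n → ℕ) μ ν →
                  sum (λ x → ν x * out α μ x) ≡ sum (λ x → μ x * inn α ν x)
sum-out≡sum-inn α μ ν = begin-equality
  sum (λ x → ν x * out α μ x)
    ≡⟨ sum-cong (λ x → sum-*ˡ (ν x) _) ⟩
  sum (λ x → sum (λ y → ν x * (μ y * α x y)))
    ≡⟨ sum-comm _ ⟩
  sum (λ y → sum (λ x → ν x * (μ y * α x y)))
    ≡⟨ sum-cong (λ y → sum-cong (λ x → swap (ν x) (μ y) (α x y))) ⟩
  sum (λ y → sum (λ x → μ y * (ν x * α x y)))
    ≡⟨ sum-cong (λ y → sym (sum-*ˡ (μ y) _)) ⟩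
  sum (λ y → μ y * inn α ν y) ∎
  where
  open ≤-Reasoning
  swap : ∀ a b c → a * (b * c) ≡ b * (a * c)
  swap = solve-∀

module _ (T : Tournament n) where

  private α = adj T

  -- Each pair inside a set of p vertices carries one arc, and 2 · p(p - 1)/2 + p = p². Idempotence
  -- says that μ takes only the values 0 and 1.
  handshake : ∀ μ → (∀ x → μ x * μ x ≡ μ x) →
              2 * sum (λ x → μ x * out α μ x) + sum μ ≡ sum μ * sum μ
  handshake μ idem = begin-equality
    2 * S + sum μ
      ≡⟨ cong (_+ sum μ) (cong (S +_) (trans (+-identityʳ S) (sum-out≡sum-inn α μ μ))) ⟩
    S + sum (λ x → μ x * inn α μ x) + sum μ
      ≡⟨ cong (_+ sum μ) (sym (sum-+ _ _)) ⟩
    sum (λ x → μ x * out α μ x + μ x * inn α μ x) + sum μ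
      ≡⟨ sym (sum-+ _ _) ⟩
    sum (λ x → μ x * out α μ x + μ x * inn α μ x + μ x)
      ≡⟨ sum-cong (λ x → trans (cong (μ x * out α μ x + μ x * inn α μ x +_) (sym (idem x)))
           (trans (factor (μ x) _ _) (cong (μ x *_) (degree-total T μ x)))) ⟩
    sum (λ x → μ x * sum μ)
      ≡⟨ sym (sum-*ʳ (sum μ) μ) ⟩
    sum μ * sum μ ∎
    where
    open ≤-Reasoning
    S = sum λ x → μ x * out α μ x
    factor : ∀ m a b → m * a + m * b + m * m ≡ m * (a + b + m)
    factor = solve-∀

record Regular (k : ℕ) (T : Tournament n) : Set where
  field
    order     : n ≡ 4 * k + 3
    outdegree : ∀ x → sum (adj T x) ≡ 2 * k + 1
    common    : ∀ {x y} → x ≢ y → sum (λ z → adj T x z * adj T y z) ≡ k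

  indegree : ∀ x → sum (λ y → adj T y x) ≡ 2 * k + 1
  indegree x = +-cancelˡ-≡ (2 * k + 1) _ _ (+-cancelʳ-≡ 1 _ _ (begin-equality
    2 * k + 1 + sum (λ y → adj T y x) + 1
      ≡⟨ cong (λ d → d + sum (λ y → adj T y x) + 1) (sym (outdegree x)) ⟩
    sum (adj T x) + sum (λ y → adj T y x) + 1
      ≡⟨ cong₂ (λ a b → a + b + 1)
           (sum-cong (λ y → sym (*-identityˡ _))) (sum-cong (λ y → sym (*-identityˡ _))) ⟩
    out (adj T) (λ _ → 1) x + inn (adj T) (λ _ → 1) x + 1
      ≡⟨ degree-total T (λ _ → 1) x ⟩
    sum {n} (λ _ → 1)
      ≡⟨ trans (sum-const n 1) (*-identityʳ n) ⟩
    n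
      ≡⟨ order ⟩
    4 * k + 3
      ≡⟨ split k ⟩
    2 * k + 1 + (2 * k + 1) + 1 ∎))
    where
    open ≤-Reasoning
    split : ∀ k → 4 * k + 3 ≡ 2 * k + 1 + (2 * k + 1) + 1
    split = solve-∀

another : 2 ≤ n → (x : Fin n) → ∃ λ y → y ≢ x
another (s≤s (s≤s _)) zero    = suc zero , λ ()
another (s≤s (s≤s _)) (suc x) = zero , λ ()

-- Two applications of `handshake`: inside the out-neighbourhood of x it gives the out-degree 2m +
-- 1, and on all vertices it then gives the order 4m + 3, so m = k.
doublyRegular⇒Regular : ∀ k (T : Tournament (4 * k + 3)) → DoublyRegular T → Regular k T
doublyRegular⇒Regular k T (m , 1≤m , meets) = record
  { order     = refl
  ; outdegree = λ x → trans (deg x) (cong (λ m → 2 * m + 1) m≡k)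
  ; common    = λ x≢y → trans (common x≢y) m≡k
  }
  where
  open ≤-Reasoning
  n′ = 4 * k + 3
  α = adj T

  common : ∀ {x y} → x ≢ y → sum (λ z → α x z * α y z) ≡ m
  common {x} {y} x≢y = begin-equality
    sum (λ z → α x z * α y z)
      ≡⟨ sum-cong (λ z → sym (χ-∩ (arcs T x) (arcs T y) z)) ⟩
    sum (χ (arcs T x ∩ arcs T y))
      ≡⟨ sum-χ (arcs T x ∩ arcs T y) ⟩
    ∣ arcs T x ∩ arcs T y ∣
      ≡⟨ meets x y x≢y ⟩
    m ∎

  -- The subtournament induced by the out-neighbours of x is m-regular.
  deg : ∀ x → sum (α x) ≡ 2 * m + 1
  deg x = cancel (sum (α x)) 0<d (begin-equality
    sum (α x) * (2 * m + 1)
      ≡⟨ expand (sum (α x)) m ⟩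
    2 * (sum (α x) * m) + sum (α x)
      ≡⟨ cong (λ s → 2 * s + sum (α x)) (trans (sum-*ʳ m (α x)) (sum-cong inside-out)) ⟩
    2 * sum (λ y → α x y * out α (α x) y) + sum (α x)
      ≡⟨ handshake T (α x) (χ-idem (arcs T x)) ⟩
    sum (α x) * sum (α x) ∎)
    where
    expand : ∀ d m → d * (2 * m + 1) ≡ 2 * (d * m) + d
    expand = solve-∀
    inside-out : ∀ y → α x y * m ≡ α x y * out α (α x) y
    inside-out y with x ≟ y
    ... | yes refl rewrite adj-irrefl T x = refl
    ... | no x≢y   = cong (α x y *_) (sym (common x≢y))
    -- A factor d is to be cancelled from d(2m + 1) = d². It is positive because x shares m ≥ 1
    -- out-neighbours with some other vertex.
    0<d : 0 < sum (α x)
    0<d = let y , y≢x = another (m≤n⇒m≤o+n (4 * k) (s≤s (s≤s z≤n))) x in begin-strict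
      0                         <⟨ 1≤m ⟩
      m                         ≡⟨ sym (common y≢x) ⟩
      sum (λ z → α y z * α x z) ≤⟨ sum-mono (λ z →
        ≤-trans (*-monoˡ-≤ (α x z) (χ-≤1 (arcs T y) z)) (≤-reflexive (*-identityˡ _))) ⟩
      sum (α x)                 ∎
    cancel : ∀ d → 0 < d → d * (2 * m + 1) ≡ d * d → d ≡ 2 * m + 1
    cancel (suc d) _ eq = sym (*-cancelˡ-≡ _ _ (suc d) eq)

  m≡k : m ≡ k
  m≡k = *-cancelˡ-≡ m k 4 (+-cancelʳ-≡ 3 (4 * m) (4 * k) (*-cancelˡ-≡ _ _ n′ {{n≢0}} (begin-equality
    n′ * (4 * m + 3)
      ≡⟨ expand n′ m ⟩
    2 * (n′ * (2 * m + 1)) + n′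
      ≡⟨ cong₂ (λ s t → 2 * s + t) (sym (sum-const n′ (2 * m + 1))) (sym n′≡) ⟩
    2 * sum {n′} (λ _ → 2 * m + 1) + sum {n′} (λ _ → 1)
      ≡⟨ cong (λ s → 2 * s + sum {n′} (λ _ → 1)) (sum-cong λ x →
           trans (sym (deg x)) (trans (sum-cong λ y → sym (*-identityˡ (α x y))) (sym (*-identityˡ _)))) ⟩
    2 * sum {n′} (λ x → 1 * out α (λ _ → 1) x) + sum {n′} (λ _ → 1)
      ≡⟨ handshake T (λ _ → 1) (λ _ → refl) ⟩
    sum {n′} (λ _ → 1) * sum {n′} (λ _ → 1)
      ≡⟨ cong₂ _*_ n′≡ n′≡ ⟩
    n′ * n′ ∎)))
    where
    n′≡ : sum {n′} (λ _ → 1) ≡ n′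
    n′≡ = trans (sum-const n′ 1) (*-identityʳ n′)
    n≢0 = >-nonZero {n′} (m≤n⇒m≤o+n (4 * k) (s≤s z≤n))
    expand : ∀ n m → n * (4 * m + 3) ≡ 2 * (n * (2 * m + 1)) + n
    expand = solve-∀

-- The cost of a module in a doubly regular tournament

-- Matching on this type turns three indicator values into numerals at once, according to the part
-- of the partition that contains the vertex.
data OneOf : ℕ → ℕ → ℕ → Set where
  first  : OneOf 1 0 0
  second : OneOf 0 1 0
  third  : OneOf 0 0 1

oneOf : ∀ a b c → a + b + c ≡ 1 → OneOf a b c
oneOf 1       0       0       refl = first
oneOf 0       1       0       refl = second
oneOf 0       0       1       refl = third
oneOf (suc (suc _)) _ _ ()
oneOf 1 (suc _) _ ()
oneOf 1 0 (suc _) ()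
oneOf 0 (suc (suc _)) _ ()
oneOf 0 1 (suc _) ()
oneOf 0 0 (suc (suc _)) ()
oneOf 0 0 0 ()

-- The gap is the square of the difference; comparing a and b first lets that difference be a
-- natural number d.
4ab≤[a+b]² : ∀ a b → 4 * (a * b) ≤ (a + b) * (a + b)
4ab≤[a+b]² a b with ≤-total a b
... | inj₁ a≤b rewrite sym (m+[n∸m]≡n a≤b) = m+n≤o⇒m≤o _ (≤-reflexive (square a (b ∸ a)))
  where
  square : ∀ a d → 4 * (a * (a + d)) + d * d ≡ (a + (a + d)) * (a + (a + d))
  square = solve-∀
... | inj₂ b≤a rewrite sym (m+[n∸m]≡n b≤a) = m+n≤o⇒m≤o _ (≤-reflexive (square b (a ∸ b)))
  where
  square : ∀ b d → 4 * ((b + d) * b) + d * d ≡ (b + d + b) * (b + d + b)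
  square = solve-∀

-- Here μ, ρ and κ indicate M, R and the remaining set Q. Below, p, l and q are their sizes, P = p -
-- 1 and h = k - l, so that the target `k + suc h` is 2k + 1 - l.
module Cut {k} {T : Tournament n} (reg : Regular k T) (μ ρ κ : Fin n → ℕ)
           (partition : ∀ x → μ x + ρ x + κ x ≡ 1) where

  open Regular reg
  open ≤-Reasoning

  α = adj T

  a b : Fin n → ℕ
  a = out α μ
  b = inn α μ

  cut : ℕ
  cut = sum λ x → κ x * (a x ⊓ b x)

  μ-idem : ∀ x → μ x * μ x ≡ μ x
  μ-idem x with μ x | ρ x | κ x | oneOf (μ x) (ρ x) (κ x) (partition x)
  ... | _ | _ | _ | first  = refl
  ... | _ | _ | _ | second = refl
  ... | _ | _ | _ | third  = refl

  -- With A the adjacency matrix and J the all-ones matrix, this is A Aᵀ = kJ + (k + 1)I; the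
  -- diagonal entry is the out-degree 2k + 1.
  gram : ∀ y z → sum (λ x → α y x * α z x) ≡ k + (k + 1) * δ y z
  gram y z with y ≟ z
  ... | no y≢z rewrite δ-≢ y≢z = trans (common y≢z)
    (sym (trans (cong (k +_) (*-zeroʳ (k + 1))) (+-identityʳ k)))
  ... | yes refl rewrite δ-refl y =
    trans (sum-cong (χ-idem (arcs T y))) (trans (outdegree y) (split k))
    where
    split : ∀ k → 2 * k + 1 ≡ k + (k + 1) * 1
    split = solve-∀

  -- Counts the arcs with tail in M.
  first-moment : sum b ≡ sum μ * (2 * k + 1)
  first-moment = begin-equality
    sum b                                ≡⟨ sum-cong (λ x → sym (*-identityˡ (b x))) ⟩
    sum (λ x → 1 * b x)                  ≡⟨ sym (sum-out≡sum-inn α (λ _ → 1) μ) ⟩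
    sum (λ y → μ y * out α (λ _ → 1) y)  ≡⟨ sum-cong (λ y → cong (μ y *_)
      (trans (sum-cong (λ x → *-identityˡ (α y x))) (outdegree y))) ⟩
    sum (λ y → μ y * (2 * k + 1))        ≡⟨ sym (sum-*ʳ (2 * k + 1) μ) ⟩
    sum μ * (2 * k + 1)                  ∎

  -- As a vector b is Aᵀμ, so the sum is μᵀ(A Aᵀ)μ, which `gram` evaluates.
  second-moment : sum (λ x → b x * b x) ≡ sum μ * (sum μ * k + (k + 1))
  second-moment = begin-equality
    sum (λ x → b x * b x)
      ≡⟨ sym (sum-out≡sum-inn α b μ) ⟩
    sum (λ y → μ y * out α b y)
      ≡⟨ sum-cong (λ y → cong (μ y *_) (row y)) ⟩
    sum (λ y → μ y * (sum μ * k + (k + 1) * μ y))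
      ≡⟨ sum-cong (λ y → trans (expand (μ y) _ (k + 1))
           (cong (λ m → μ y * (sum μ * k) + (k + 1) * m) (μ-idem y))) ⟩
    sum (λ y → μ y * (sum μ * k) + (k + 1) * μ y)
      ≡⟨ sum-+ _ _ ⟩
    sum (λ y → μ y * (sum μ * k)) + sum (λ y → (k + 1) * μ y)
      ≡⟨ cong₂ _+_ (sym (sum-*ʳ _ μ)) (sym (sum-*ˡ (k + 1) μ)) ⟩
    sum μ * (sum μ * k) + (k + 1) * sum μ
      ≡⟨ collect (sum μ) _ _ ⟩
    sum μ * (sum μ * k + (k + 1)) ∎
    where
    expand : ∀ m c d → m * (c + d * m) ≡ m * c + d * (m * m)
    expand = solve-∀
    collect : ∀ m c d → m * c + d * m ≡ m * (c + d)
    collect = solve-∀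
    distrib : ∀ m k d → m * (k + (k + 1) * d) ≡ m * k + (k + 1) * (d * m)
    distrib = solve-∀
    -- `out α b y` is the entry of A Aᵀμ at y.
    row : ∀ y → out α b y ≡ sum μ * k + (k + 1) * μ y
    row y = begin-equality
      sum (λ x → b x * α y x)
        ≡⟨ sum-cong (λ x → *-comm (b x) (α y x)) ⟩
      sum (λ x → α y x * b x)
        ≡⟨ sym (sum-out≡sum-inn α (α y) μ) ⟩
      sum (λ z → μ z * out α (α y) z)
        ≡⟨ sum-cong (λ z → trans (cong (μ z *_) (gram y z)) (distrib (μ z) k (δ y z))) ⟩
      sum (λ z → μ z * k + (k + 1) * (δ y z * μ z))
        ≡⟨ sum-+ _ _ ⟩
      sum (λ z → μ z * k) + sum (λ z → (k + 1) * (δ y z * μ z))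
        ≡⟨ cong₂ _+_ (sym (sum-*ʳ k μ)) (sym (sum-*ˡ (k + 1) _)) ⟩
      sum μ * k + (k + 1) * sum (λ z → δ y z * μ z)
        ≡⟨ cong (λ s → sum μ * k + (k + 1) * s) (sum-δ y μ) ⟩
      sum μ * k + (k + 1) * μ y ∎

  -- Since a + μ = p - b, this is p times the first moment minus the second; the second is added to
  -- both sides to avoid the subtraction.
  total : ∀ {P} → sum μ ≡ suc P →
          sum (λ x → b x * (a x + μ x)) ≡ (k + 1) * (suc P * P)
  total {P} p≡ = +-cancelʳ-≡ (sum (λ x → b x * b x)) _ _ (begin-equality
    sum (λ x → b x * (a x + μ x)) + sum (λ x → b x * b x)
      ≡⟨ sym (sum-+ _ _) ⟩
    sum (λ x → b x * (a x + μ x) + b x * b x)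
      ≡⟨ sum-cong (λ x → trans (factor (b x) (a x) (μ x)) (cong (b x *_) (degree-total T μ x))) ⟩
    sum (λ x → b x * sum μ)
      ≡⟨ sym (sum-*ʳ (sum μ) b) ⟩
    sum b * sum μ
      ≡⟨ cong (_* sum μ) first-moment ⟩
    sum μ * (2 * k + 1) * sum μ
      ≡⟨ cong (λ p → p * (2 * k + 1) * p) p≡ ⟩
    suc P * (2 * k + 1) * suc P
      ≡⟨ rearrange k P ⟩
    (k + 1) * (suc P * P) + suc P * (suc P * k + (k + 1))
      ≡⟨ cong (λ p → (k + 1) * (suc P * P) + p * (p * k + (k + 1))) (sym p≡) ⟩
    (k + 1) * (suc P * P) + sum μ * (sum μ * k + (k + 1))
      ≡⟨ cong ((k + 1) * (suc P * P) +_) (sym second-moment) ⟩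
    (k + 1) * (suc P * P) + sum (λ x → b x * b x) ∎)
    where
    factor : ∀ b a m → b * (a + m) + b * b ≡ b * (a + b + m)
    factor = solve-∀
    rearrange : ∀ k P → suc P * (2 * k + 1) * suc P
                ≡ (k + 1) * (suc P * P) + suc P * (suc P * k + (k + 1))
    rearrange = solve-∀

  inner : ∀ {P} → sum μ ≡ suc P → 2 * sum (λ x → μ x * b x) ≡ suc P * P
  inner {P} p≡ = +-cancelʳ-≡ (suc P) _ _ (begin-equality
    2 * sum (λ x → μ x * b x) + suc P
      ≡⟨ cong₂ (λ s p → 2 * s + p) (sym (sum-out≡sum-inn α μ μ)) (sym p≡) ⟩
    2 * sum (λ x → μ x * a x) + sum μ
      ≡⟨ handshake T μ μ-idem ⟩
    sum μ * sum μ
      ≡⟨ cong₂ _*_ p≡ p≡ ⟩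
    suc P * suc P
      ≡⟨ *-suc (suc P) P ⟩
    suc P + suc P * P
      ≡⟨ +-comm (suc P) _ ⟩
    suc P * P + suc P ∎)

  -- On M, a + b = P gives 4ab ≤ P². On R, a + b = p gives 4ab ≤ p² ≤ 2Pp. On Q, ab is the maximum
  -- times the minimum, and the maximum is at most P unless the minimum vanishes.
  4b[a+μ]≤ : ∀ {P} → sum μ ≡ suc P → 1 ≤ P → ∀ x →
             4 * (b x * (a x + μ x)) ≤
             μ x * (P * P) + 4 * (μ x * b x) + ρ x * (2 * (P * suc P)) + 4 * P * (κ x * (a x ⊓ b x))
  4b[a+μ]≤ {P} p≡ 1≤P x
    with μ x | ρ x | κ x | oneOf (μ x) (ρ x) (κ x) (partition x) | trans (degree-total T μ x) p≡
  ... | _ | _ | _ | first | a+b+1≡p = begin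
    4 * (b x * (a x + 1))              ≡⟨ expand (a x) (b x) ⟩
    4 * (a x * b x) + 4 * b x          ≤⟨ +-monoˡ-≤ (4 * b x) (4ab≤[a+b]² (a x) (b x)) ⟩
    (a x + b x) * (a x + b x) + 4 * b x ≡⟨ cong (λ s → s * s + 4 * b x) a+b≡P ⟩
    P * P + 4 * b x                    ≡⟨ pad P (b x) (a x ⊓ b x) ⟩
    1 * (P * P) + 4 * (1 * b x) + 0 + 4 * P * (0 * (a x ⊓ b x)) ∎
    where
    a+b≡P : a x + b x ≡ P
    a+b≡P = suc-injective (trans (+-comm 1 (a x + b x)) a+b+1≡p)
    expand : ∀ a b → 4 * (b * (a + 1)) ≡ 4 * (a * b) + 4 * b
    expand = solve-∀
    pad : ∀ P b m → P * P + 4 * b ≡ 1 * (P * P) + 4 * (1 * b) + 0 + 4 * P * (0 * m)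
    pad = solve-∀
  ... | _ | _ | _ | second | a+b+0≡p = begin
    4 * (b x * (a x + 0))     ≡⟨ expand (a x) (b x) ⟩
    4 * (a x * b x)           ≤⟨ 4ab≤[a+b]² (a x) (b x) ⟩
    (a x + b x) * (a x + b x) ≡⟨ cong (λ s → s * s) (trans (sym (+-identityʳ _)) a+b+0≡p) ⟩
    -- From 1 ≤ P follows p = P + 1 ≤ 2P.
    suc P * suc P             ≤⟨ *-monoˡ-≤ (suc P) (+-monoˡ-≤ P 1≤P) ⟩
    (P + P) * suc P           ≡⟨ pad P (a x ⊓ b x) ⟩
    0 + 4 * 0 + 1 * (2 * (P * suc P)) + 4 * P * (0 * (a x ⊓ b x)) ∎
    where
    expand : ∀ a b → 4 * (b * (a + 0)) ≡ 4 * (a * b)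
    expand = solve-∀
    pad : ∀ P m → (P + P) * suc P ≡ 0 + 4 * 0 + 1 * (2 * (P * suc P)) + 4 * P * (0 * m)
    pad = solve-∀
  ... | _ | _ | _ | third | a+b+0≡p = begin
    4 * (b x * (a x + 0))     ≡⟨ expand (a x) (b x) ⟩
    4 * (a x * b x)           ≤⟨ *-monoʳ-≤ 4 (ab≤ (a x) (b x) (trans (sym (+-identityʳ _)) a+b+0≡p)) ⟩
    4 * (P * (a x ⊓ b x))     ≡⟨ pad P (a x ⊓ b x) ⟩
    0 + 4 * 0 + 0 + 4 * P * (1 * (a x ⊓ b x)) ∎
    where
    expand : ∀ a b → 4 * (b * (a + 0)) ≡ 4 * (a * b)
    expand = solve-∀
    pad : ∀ P m → 4 * (P * m) ≡ 0 + 4 * 0 + 0 + 4 * P * (1 * m)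
    pad = solve-∀
    ab≤ : ∀ a b → a + b ≡ suc P → a * b ≤ P * (a ⊓ b)
    ab≤ zero    b       _  = z≤n
    ab≤ (suc a) zero    _  = ≤-trans (≤-reflexive (*-zeroʳ a)) z≤n
    ab≤ (suc a) (suc b) eq with ≤-total a b
    ... | inj₁ a≤b rewrite m≤n⇒m⊓n≡m a≤b = ≤-trans (≤-reflexive (*-comm (suc a) (suc b)))
      (*-monoˡ-≤ (suc a) (m+n≤o⇒n≤o a (≤-reflexive (suc-injective eq))))
    ... | inj₂ b≤a rewrite m≥n⇒m⊓n≡n b≤a = *-monoˡ-≤ (suc b)
      (m+n≤o⇒m≤o (suc a) (≤-reflexive (trans (sym (+-suc a b)) (suc-injective eq))))

  -- Compares `total` with the sum of the pointwise bounds. By `inner` the term 4b contributes 2pP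
  -- on M, after which every term has a factor P to cancel.
  quadratic : ∀ {P} → sum μ ≡ suc P → 1 ≤ P →
              4 * (k + 1) * suc P ≤ suc P * (P + 2 + 2 * sum ρ) + 4 * cut
  quadratic {P@(suc P′)} p≡ 1≤P = *-cancelˡ-≤ P (begin
    P * (4 * (k + 1) * suc P)
      ≡⟨ rearrangeˡ k P ⟩
    4 * ((k + 1) * (suc P * P))
      ≡⟨ cong (4 *_) (sym (total p≡)) ⟩
    4 * sum (λ x → b x * (a x + μ x))
      ≡⟨ sum-*ˡ 4 _ ⟩
    sum (λ x → 4 * (b x * (a x + μ x)))
      ≤⟨ sum-mono (4b[a+μ]≤ p≡ 1≤P) ⟩
    sum (λ x → μ x * (P * P) + 4 * (μ x * b x) + ρ x * (2 * (P * suc P)) + 4 * P * (κ x * (a x ⊓ b x)))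
      ≡⟨ trans (sum-+ _ _) (cong₂ _+_ (trans (sum-+ _ _) (cong₂ _+_ (sum-+ _ _) refl)) refl) ⟩
    sum (λ x → μ x * (P * P)) + sum (λ x → 4 * (μ x * b x))
      + sum (λ x → ρ x * (2 * (P * suc P))) + sum (λ x → 4 * P * (κ x * (a x ⊓ b x)))
      ≡⟨ sym (cong₂ _+_ (cong₂ _+_ (cong₂ _+_ (sum-*ʳ _ μ) (sum-*ˡ 4 _)) (sum-*ʳ _ ρ)) (sum-*ˡ (4 * P) _)) ⟩
    sum μ * (P * P) + 4 * sum (λ x → μ x * b x) + sum ρ * (2 * (P * suc P)) + 4 * P * cut
      ≡⟨ cong₂ (λ p s → p * (P * P) + s + sum ρ * (2 * (P * suc P)) + 4 * P * cut) p≡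
           (trans (double (sum λ x → μ x * b x)) (cong (2 *_) (inner p≡))) ⟩
    suc P * (P * P) + 2 * (suc P * P) + sum ρ * (2 * (P * suc P)) + 4 * P * cut
      ≡⟨ rearrangeʳ P (sum ρ) cut ⟩
    P * (suc P * (P + 2 + 2 * sum ρ) + 4 * cut) ∎)
    where
    rearrangeˡ : ∀ k P → P * (4 * (k + 1) * suc P) ≡ 4 * ((k + 1) * (suc P * P))
    rearrangeˡ = solve-∀
    rearrangeʳ : ∀ P l c → suc P * (P * P) + 2 * (suc P * P) + l * (2 * (P * suc P)) + 4 * P * c
                 ≡ P * (suc P * (P + 2 + 2 * l) + 4 * c)
    rearrangeʳ = solve-∀
    double : ∀ s → 4 * s ≡ 2 * (2 * s)
    double = solve-∀

  -- With p = 2 + i and j = 2k + 1 - p, `quadratic` becomes p(j + 2h + 2) ≤ 4 cut. The left side is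
  -- 2(2k + 1) + 4h + i(j + 2h), so 4 cut ≥ 4(k + h) + 2, and integrality lifts the cut to k + h +
  -- 1.
  cut-bound-small : ∀ {h i j} → sum ρ + h ≡ k → sum μ ≡ 2 + i → sum μ + j ≡ 2 * k + 1 →
                    k + suc h ≤ cut
  cut-bound-small {h} {i} {j} refl p≡ p+j≡ = ≤-trans (≤-reflexive (+-suc k h))
    (*-cancelˡ-< 4 (k + h) cut (<-≤-trans below (+-cancelˡ-≤ ((2 + i) * (i + 3 + 2 * l)) _ _ (begin
      (2 + i) * (i + 3 + 2 * l) + (2 + i) * (j + 2 * h + 2)
        ≡⟨ collect i l j h ⟩
      (2 + i) * (((2 + i) + j) + 2 * (l + h) + 3)
        ≡⟨ cong (λ s → (2 + i) * (s + 2 * k + 3)) 2+i+j≡ ⟩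
      (2 + i) * (2 * k + 1 + 2 * k + 3)
        ≡⟨ double i k ⟩
      4 * (k + 1) * suc (suc i)
        ≤⟨ quadratic p≡ (s≤s z≤n) ⟩
      (2 + i) * (suc i + 2 + 2 * l) + 4 * cut
        ≡⟨ cong (λ s → (2 + i) * (s + 2 * l) + 4 * cut) (+-comm (suc i) 2) ⟩
      (2 + i) * (2 + suc i + 2 * l) + 4 * cut
        ≡⟨ cong (λ s → (2 + i) * (s + 2 * l) + 4 * cut) (+-comm 3 i) ⟩
      (2 + i) * (i + 3 + 2 * l) + 4 * cut ∎))))
    where
    l = sum ρ
    2+i+j≡ : 2 + i + j ≡ 2 * k + 1
    2+i+j≡ = trans (cong (_+ j) (sym p≡)) p+j≡
    collect : ∀ i l j h → (2 + i) * (i + 3 + 2 * l) + (2 + i) * (j + 2 * h + 2)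
              ≡ (2 + i) * (((2 + i) + j) + 2 * (l + h) + 3)
    collect = solve-∀
    double : ∀ i k → (2 + i) * (2 * k + 1 + 2 * k + 3) ≡ 4 * (k + 1) * suc (suc i)
    double = solve-∀
    spread : ∀ k h → suc (suc (4 * (k + h))) ≡ 2 * (2 * k + 1) + 4 * h
    spread = solve-∀
    expand : ∀ i j h → 2 * (2 + i + j) + 4 * h + i * (j + 2 * h) ≡ (2 + i) * (j + 2 * h + 2)
    expand = solve-∀
    below : 4 * (k + h) < (2 + i) * (j + 2 * h + 2)
    below = begin
      suc (4 * (k + h))        ≤⟨ n≤1+n _ ⟩
      suc (suc (4 * (k + h)))  ≡⟨ spread k h ⟩
      2 * (2 * k + 1) + 4 * h  ≡⟨ cong (λ s → 2 * s + 4 * h) (sym 2+i+j≡) ⟩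
      2 * (2 + i + j) + 4 * h  ≤⟨ m≤m+n _ (i * (j + 2 * h)) ⟩
      2 * (2 + i + j) + 4 * h + i * (j + 2 * h) ≡⟨ expand i j h ⟩
      (2 + i) * (j + 2 * h + 2) ∎

  -- Used with f the out-neighbourhood or the in-neighbourhood of x. Of these 2k + 1 vertices at
  -- most l lie in R and at most q - κ x in Q, as x is not its own neighbour; the others lie in M.
  weight-bound : ∀ {x} {f : Fin n → ℕ} → (∀ y → f y ≤ 1) → sum f ≡ 2 * k + 1 →
                 sum (λ y → κ y * f y) + κ x ≤ sum κ →
                 2 * k + 1 + κ x ≤ sum (λ y → μ y * f y) + sum ρ + sum κ
  weight-bound {x} {f} f≤1 f≡ κ-bound = begin
    2 * k + 1 + κ x
      ≡⟨ cong (_+ κ x) (sym f≡) ⟩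
    sum f + κ x
      ≡⟨ cong (_+ κ x) (sum-cong (λ y → trans (sym (trans (cong (_* f y) (partition y)) (*-identityˡ (f y))))
           (distrib (μ y) (ρ y) (κ y) (f y)))) ⟩
    sum (λ y → μ y * f y + ρ y * f y + κ y * f y) + κ x
      ≡⟨ cong (_+ κ x) (trans (sum-+ _ _) (cong₂ _+_ (sum-+ _ _) refl)) ⟩
    sum (λ y → μ y * f y) + sum (λ y → ρ y * f y) + sum (λ y → κ y * f y) + κ x
      ≡⟨ +-assoc (sum (λ y → μ y * f y) + sum (λ y → ρ y * f y)) _ _ ⟩
    sum (λ y → μ y * f y) + sum (λ y → ρ y * f y) + (sum (λ y → κ y * f y) + κ x)
      ≤⟨ +-mono-≤ (+-monoʳ-≤ (sum (λ y → μ y * f y)) (sum-mono (λ y →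
           ≤-trans (*-monoʳ-≤ (ρ y) (f≤1 y)) (≤-reflexive (*-identityʳ (ρ y)))))) κ-bound ⟩
    sum (λ y → μ y * f y) + sum ρ + sum κ ∎
    where
    distrib : ∀ m r q f → (m + r + q) * f ≡ m * f + r * f + q * f
    distrib = solve-∀

  -- Let s = k + h + 1. Each vertex of Q has at least s + 1 - q out-neighbours and as many
  -- in-neighbours in M, so the cut is at least q(s + 1 - q) = s + (q - 1)(s - q) ≥ s. Adding q² to
  -- both sides avoids the subtraction.
  cut-bound-large : ∀ {h q′ j} → sum ρ + h ≡ k → sum κ ≡ suc q′ → sum κ + j ≡ k + suc h →
                    k + suc h ≤ cut
  cut-bound-large {h} {q′} {j} refl q≡ q+j≡ = +-cancelʳ-≤ (q * q) s cut (begin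
    s + q * q
      ≡⟨ cong₂ (λ s q → s + q * q) (trans (sym q+j≡) (cong (_+ j) q≡)) q≡ ⟩
    suc q′ + j + suc q′ * suc q′
      ≤⟨ m≤m+n _ (q′ * j) ⟩
    suc q′ + j + suc q′ * suc q′ + q′ * j
      ≡⟨ collect q′ j ⟩
    suc q′ * (suc q′ + j + 1)
      ≡⟨ cong₂ (λ q s → q * (s + 1)) (sym q≡) (trans (cong (_+ j) (sym q≡)) q+j≡) ⟩
    q * (s + 1)
      ≡⟨ sum-*ʳ (s + 1) κ ⟩
    sum (λ x → κ x * (s + 1))
      ≤⟨ sum-mono pointwise ⟩
    sum (λ x → κ x * (a x ⊓ b x) + κ x * q)
      ≡⟨ trans (sum-+ _ _) (cong₂ _+_ refl (sym (sum-*ʳ q κ))) ⟩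
    cut + q * q ∎)
    where
    q = sum κ
    l = sum ρ
    s = k + suc h
    collect : ∀ q j → suc q + j + suc q * suc q + q * j ≡ suc q * (suc q + j + 1)
    collect = solve-∀
    swap : ∀ a b c → a + b + c ≡ a + c + b
    swap = solve-∀
    split : ∀ l h → 2 * (l + h) + 1 + 1 ≡ l + ((l + h) + suc h + 1)
    split = solve-∀
    join : ∀ a l q → a + l + q ≡ l + (a + q)
    join = solve-∀
    out-bound : ∀ x → 2 * k + 1 + κ x ≤ a x + l + q
    out-bound x = weight-bound (χ-≤1 (arcs T x)) (outdegree x)
      (m+n≤o⇒m≤o _ (≤-reflexive (trans (swap (out α κ x) (κ x) _) (degree-total T κ x))))
    inn-bound : ∀ x → 2 * k + 1 + κ x ≤ b x + l + q
    inn-bound x = weight-bound (λ y → χ-≤1 (arcs T y) x) (indegree x)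
      (m+n≤o⇒n≤o (out α κ x) (≤-reflexive
        (trans (sym (+-assoc (out α κ x) _ _)) (degree-total T κ x))))
    pointwise : ∀ x → κ x * (s + 1) ≤ κ x * (a x ⊓ b x) + κ x * q
    pointwise x with μ x | ρ x | κ x | oneOf (μ x) (ρ x) (κ x) (partition x) | out-bound x | inn-bound x
    ... | _ | _ | _ | first  | _ | _ = z≤n
    ... | _ | _ | _ | second | _ | _ = z≤n
    ... | _ | _ | _ | third  | o | i = begin
      1 * (s + 1)                     ≡⟨ *-identityˡ _ ⟩
      s + 1                           ≤⟨ ⊓-glb (bound o) (bound i) ⟩
      (a x + q) ⊓ (b x + q)           ≡⟨ sym (+-distribʳ-⊓ q (a x) (b x)) ⟩
      (a x ⊓ b x) + q                 ≡⟨ cong₂ _+_ (sym (*-identityˡ (a x ⊓ b x))) (sym (*-identityˡ q)) ⟩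
      1 * (a x ⊓ b x) + 1 * q         ∎
      where
      bound : ∀ {c} → 2 * k + 1 + 1 ≤ c + l + q → s + 1 ≤ c + q
      bound {c} le = +-cancelˡ-≤ l _ _ (≤-trans (≤-reflexive (sym (split l h)))
        (≤-trans le (≤-reflexive (join c l q))))

  cut-bound : ∀ {h} → sum ρ + h ≡ k → 2 ≤ sum μ → 1 ≤ sum κ → k + suc h ≤ cut
  -- The threshold makes the two cases meet: q ≥ k + h + 2 leaves p ≤ 4k + 3 - l - (k + h + 2) = 2k
  -- + 1.
  cut-bound {h} l+h≡k 2≤p 1≤q with sum κ ≤? k + suc h
  ... | yes q≤s = cut-bound-large l+h≡k (sym (m+[n∸m]≡n 1≤q)) (m+[n∸m]≡n q≤s)
  ... | no  q≰s = cut-bound-small l+h≡k (sym (m+[n∸m]≡n 2≤p)) (m+[n∸m]≡n p≤2k+1)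
    where
    sizes : sum μ + sum ρ + sum κ ≡ 4 * k + 3
    sizes = begin-equality
      sum μ + sum ρ + sum κ         ≡⟨ cong (_+ sum κ) (sym (sum-+ μ ρ)) ⟩
      sum (λ x → μ x + ρ x) + sum κ ≡⟨ sym (sum-+ _ κ) ⟩
      sum (λ x → μ x + ρ x + κ x)   ≡⟨ sum-cong partition ⟩
      sum {n} (λ _ → 1)             ≡⟨ trans (sum-const n 1) (*-identityʳ n) ⟩
      n                             ≡⟨ order ⟩
      4 * k + 3                     ∎
    regroup : ∀ p l h → p + (2 * (l + h) + 2) ≡ p + l + suc (l + h + suc h)
    regroup = solve-∀
    split : ∀ k → 4 * k + 3 ≡ 2 * k + 1 + (2 * k + 2)
    split = solve-∀
    p≤2k+1 : sum μ ≤ 2 * k + 1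
    p≤2k+1 = +-cancelʳ-≤ (2 * k + 2) _ _ (begin
      sum μ + (2 * k + 2)                     ≡⟨ cong (λ k → sum μ + (2 * k + 2)) (sym l+h≡k) ⟩
      sum μ + (2 * (sum ρ + h) + 2)           ≡⟨ regroup (sum μ) (sum ρ) h ⟩
      sum μ + sum ρ + suc (sum ρ + h + suc h) ≡⟨ cong (λ k → sum μ + sum ρ + suc (k + suc h)) l+h≡k ⟩
      sum μ + sum ρ + suc (k + suc h)         ≤⟨ +-monoʳ-≤ (sum μ + sum ρ) (≰⇒> q≰s) ⟩
      sum μ + sum ρ + sum κ                   ≡⟨ sizes ⟩
      4 * k + 3                               ≡⟨ split k ⟩
      2 * k + 1 + (2 * k + 2)                 ∎)

-- Lower bound

size-sum : (P : PairSet n) → size P ≡ sum (λ x → sum (χ (P x)))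
size-sum P = trans (sum-size P) (sum-cong λ x → sym (sum-χ (P x)))

weight≤total : ∀ (S : Subset n) (f : Fin n → ℕ) → sum (λ y → χ S y * f y) ≤ sum f
weight≤total S f = sum-mono λ y →
  ≤-trans (*-monoˡ-≤ (f y) (χ-≤1 S y)) (≤-reflexive (*-identityˡ (f y)))

χ-mono : {S U : Subset n} {x y : Fin n} → (x ∈ S → y ∈ U) → χ S x ≤ χ U y
χ-mono {S = S} {x = x} S⇒U with x ∈? S
... | yes x∈S rewrite χ-∈ (S⇒U x∈S) = χ-≤1 S x
... | no  x∉S rewrite χ-∉ S x∉S = z≤n

χ-guard : (S : Subset n) {x : Fin n} {a b : ℕ} → (x ∈ S → a ≤ b) → χ S x * a ≤ χ S x * b
χ-guard S {x} a≤b with x ∈? S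
... | yes x∈S = *-monoʳ-≤ (χ S x) (a≤b x∈S)
... | no  x∉S rewrite χ-∉ S x∉S = z≤n

module _ (T : Tournament n) (B : PairSet n) (B⊆A : B ⊆ᴾ arcs T) where

  arc-kept : ∀ {x y} → y ∈ arcs T x → y ∉ B x →
             y ∈ arcs (reverse T B B⊆A) x
  arc-kept x⟶y y∉B = x∈p∪q⁺ (inj₁ (x∈p∧x∉q⇒x∈p─q x⟶y y∉B))

  arc-flipped : ∀ {x y} → x ∈ B y → y ∈ arcs (reverse T B B⊆A) x
  arc-flipped x∈B = x∈p∪q⁺ (inj₂ (∈-converse⁺ B x∈B))

module _ (T : Tournament n) (B : PairSet n) (B⊆A : B ⊆ᴾ arcs T)
         (M : Subset n) (M-module : IsModule (reverse T B B⊆A) M) where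

  open Tournament T hiding (arcs)
  private
    module T′ = Tournament (reverse T B B⊆A)
    β : Fin n → Fin n → ℕ
    β x = χ (B x)

  -- An arc not in B survives, and asymmetry of the reversed tournament then excludes the opposite
  -- arc.
  unflipped : ∀ {x y} → x ⟶ y → y T′.⟶ x → y ∈ B x
  unflipped {x} {y} x⟶y y⟶′x with y ∈? B x
  ... | yes y∈B = y∈B
  ... | no  y∉B = contradiction y⟶′x
    (Equivalence.to (T′.oriented x≢y) (arc-kept T B B⊆A x⟶y y∉B))
    where
    x≢y : x ≢ y
    x≢y refl = distinct x x⟶y

  -- If M dominates x after the reversal, all arcs from x to M were reversed; if x dominates M, all
  -- arcs from M to x were. Either number is at least the minimum.
  local-cost : ∀ x → x ∉ M →
               out (adj T) (χ M) x ⊓ inn (adj T) (χ M) x ≤ out β (χ M) x + inn β (χ M) x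
  local-cost x x∉M with M-module x x∉M
  ... | inj₁ M⟶′x = ≤-trans (m⊓n≤m _ _) (≤-trans
    (sum-mono λ y → χ-guard M λ y∈M → χ-mono λ x⟶y → unflipped x⟶y (M⟶′x y y∈M))
    (m≤m+n _ _))
  ... | inj₂ x⟶′M = ≤-trans (m⊓n≤n _ _) (≤-trans
    (sum-mono λ y → χ-guard M λ y∈M → χ-mono λ y⟶x → unflipped y⟶x (x⟶′M y y∈M))
    (m≤n+m _ _))

  -- Each reversed arc between M and its complement is charged at its outer end. Moving the charge
  -- to the tail leaves each row of B charged under only one of M and `∁ M`, hence at most once.
  module-cost : sum (λ x → χ (∁ M) x * (out (adj T) (χ M) x ⊓ inn (adj T) (χ M) x)) ≤ size B
  module-cost = begin
    sum (λ x → χ (∁ M) x * (out (adj T) (χ M) x ⊓ inn (adj T) (χ M) x))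
      ≤⟨ sum-mono restrict ⟩
    sum (λ x → χ (∁ M) x * out β (χ M) x + χ (∁ M) x * inn β (χ M) x)
      ≡⟨ trans (sum-+ _ _) (cong (sum (λ x → χ (∁ M) x * out β (χ M) x) +_)
           (sym (sum-out≡sum-inn β (χ (∁ M)) (χ M)))) ⟩
    sum (λ x → χ (∁ M) x * out β (χ M) x) + sum (λ x → χ M x * out β (χ (∁ M)) x)
      ≡⟨ sym (sum-+ _ _) ⟩
    sum (λ x → χ (∁ M) x * out β (χ M) x + χ M x * out β (χ (∁ M)) x)
      ≤⟨ sum-mono (λ x → +-mono-≤ (*-monoʳ-≤ (χ (∁ M) x) (weight≤total M (β x)))
                                  (*-monoʳ-≤ (χ M x) (weight≤total (∁ M) (β x)))) ⟩
    sum (λ x → χ (∁ M) x * sum (β x) + χ M x * sum (β x))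
      ≡⟨ sum-cong (λ x → trans (sym (*-distribʳ-+ (sum (β x)) (χ (∁ M) x) (χ M x)))
           (trans (cong (_* sum (β x)) (χ-∁ M x)) (*-identityˡ _))) ⟩
    sum (λ x → sum (β x))
      ≡⟨ sym (size-sum B) ⟩
    size B ∎
    where
    open ≤-Reasoning
    restrict : ∀ x → χ (∁ M) x * (out (adj T) (χ M) x ⊓ inn (adj T) (χ M) x)
                   ≤ χ (∁ M) x * out β (χ M) x + χ (∁ M) x * inn β (χ M) x
    restrict x = ≤-trans
      (χ-guard (∁ M) λ x∈∁M → local-cost x (x∈∁p⇒x∉p x∈∁M))
      (≤-reflexive (*-distribˡ-+ (χ (∁ M) x) _ _))

adj-induced : ∀ (T : Tournament n) S i j →
              adj (induced T S) i j ≡ adj T (element S i) (element S j)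
adj-induced T S i j = cong ⟦_⟧ (lookup∘tabulate _ j)

sum-χ-extend : ∀ (S : Subset n) M → sum (χ (extend S M)) ≡ ∣ M ∣
sum-χ-extend S M = trans (sum-cong λ x → sym (*-identityʳ (χ (extend S M) x)))
  (trans (sum-extend S M (λ _ → 1)) (trans (sum-cong λ i → *-identityʳ (χ M i)) (sum-χ M)))

module _ {k} {T : Tournament n} (reg : Regular k T) (R : Subset n) where

  -- Non-simplicity is a negation and yields no module. So the inequality is decided, and if it
  -- failed, every module would be trivial.
  minimal-cost : ∀ {h} → ∣ R ∣ + h ≡ k → 3 ≤ ∣ ∁ R ∣ →
                 ∀ B (B⊆A : B ⊆ᴾ arcs (remove T R)) →
                 ¬ IsSimple (reverse (remove T R) B B⊆A) → k + suc h ≤ size B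
  minimal-cost {h} l+h≡k 3≤N B B⊆A ¬simple with k + suc h ≤? size B
  ... | yes s≤ = s≤
  ... | no  s≰ = contradiction (3≤N , trivial) ¬simple
    where
    open ≤-Reasoning
    S = ∁ R
    T⁻ = remove T R
    trivial : ∀ M → IsModule (reverse T⁻ B B⊆A) M → IsTrivial M
    trivial M M-module with ∣ M ∣ in p≡ | ∣ ∁ M ∣ in q≡
    ... | 0 | _ = inj₁ (∣S∣≡0⇒S≡⊥ M p≡)
    ... | 1 | _ = inj₂ (inj₁ (∣S∣≡1⇒S≡⁅x⁆ M p≡))
    ... | suc (suc _) | 0 = inj₂ (inj₂ (∣p∣≡n⇒p≡⊤ (begin-equality
      ∣ M ∣                              ≡⟨ sym (sum-χ M) ⟩
      sum (χ M)                          ≡⟨ cong (_+ sum (χ M)) (sym (trans (sum-χ (∁ M)) q≡)) ⟩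
      sum (χ (∁ M)) + sum (χ M)          ≡⟨ sym (sum-+ _ _) ⟩
      sum (λ i → χ (∁ M) i + χ M i)      ≡⟨ sum-cong (χ-∁ M) ⟩
      sum {∣ S ∣} (λ _ → 1)              ≡⟨ trans (sum-const ∣ S ∣ 1) (*-identityʳ ∣ S ∣) ⟩
      ∣ S ∣                              ∎)))
    -- M has two elements and misses one, so `cut-bound` applies to its extension to T; the cost is
    -- then pulled back to T - R.
    ... | suc (suc _) | suc _ = contradiction (begin
      k + suc h
        ≤⟨ Cut.cut-bound reg μ ρ κ partition (trans (cong (_+ h) (sum-χ R)) l+h≡k)
             (subst (2 ≤_) (sym (trans (sum-χ-extend S M) p≡)) (s≤s (s≤s z≤n)))
             (subst (1 ≤_) (sym (trans (sum-χ-extend S (∁ M)) q≡)) (s≤s z≤n)) ⟩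
      sum (λ x → κ x * (out α μ x ⊓ inn α μ x))
        ≡⟨ sum-extend S (∁ M) _ ⟩
      sum (λ i → χ (∁ M) i * (out α μ (element S i) ⊓ inn α μ (element S i)))
        ≡⟨ sum-cong (λ i → cong₂ (λ a b → χ (∁ M) i * (a ⊓ b)) (out≡ i) (inn≡ i)) ⟩
      sum (λ i → χ (∁ M) i * (out (adj T⁻) (χ M) i ⊓ inn (adj T⁻) (χ M) i))
        ≤⟨ module-cost T⁻ B B⊆A M M-module ⟩
      size B ∎) s≰
      where
      α = adj T
      μ = χ (extend S M)
      ρ = χ R
      κ = χ (extend S (∁ M))
      partition : ∀ x → μ x + ρ x + κ x ≡ 1
      partition x = trans (swap (μ x) (ρ x) (κ x))
        (trans (cong (_+ ρ x) (extend-partition S M x)) (χ-∁ R x))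
        where
        swap : ∀ a b c → a + b + c ≡ a + c + b
        swap = solve-∀
      out≡ : ∀ i → out α μ (element S i) ≡ out (adj T⁻) (χ M) i
      out≡ i = trans (sum-extend S M _)
        (sum-cong λ j → cong (χ M j *_) (sym (adj-induced T S i j)))
      inn≡ : ∀ i → inn α μ (element S i) ≡ inn (adj T⁻) (χ M) i
      inn≡ i = trans (sum-extend S M _)
        (sum-cong λ j → cong (χ M j *_) (sym (adj-induced T S j i)))

-- Upper bound

-- An upper bound on the number of reversals is enough, as the lower bound will force equality.
record Breakable (T : Tournament n) (s : ℕ) : Set where
  field
    flips     : PairSet n
    flips⊆A   : flips ⊆ᴾ arcs T
    cheap     : size flips ≤ s
    nonsimple : ¬ IsSimple (reverse T flips flips⊆A)

module _ (T : Tournament n) (M W : Subset n) where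

  open Tournament T hiding (arcs)

  -- After the reversal of these arcs, a vertex outside M dominates M if it
  -- belongs to W and is dominated by M otherwise.
  alignment : PairSet n
  alignment x = arcs T x ∩
    (if lookup M x then ∁ M ∩ W else if lookup W x then ⊥ else M)

  alignment⊆A : alignment ⊆ᴾ arcs T
  alignment⊆A x = p∩q⊆p (arcs T x) _

  private
    module T′ = Tournament (reverse T alignment alignment⊆A)

    at-M : ∀ {x} → x ∈ M → alignment x ≡ arcs T x ∩ (∁ M ∩ W)
    at-M x∈M rewrite []=⇒lookup x∈M = refl

    at-W : ∀ {x} → x ∉ M → x ∈ W → alignment x ≡ arcs T x ∩ ⊥
    at-W {x} x∉M x∈W with lookup M x in eq
    ... | true  = contradiction (lookup⇒[]= x M eq) x∉M
    ... | false rewrite []=⇒lookup x∈W = refl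

    off-W : ∀ {x} → x ∉ M → x ∉ W → alignment x ≡ arcs T x ∩ M
    off-W {x} x∉M x∉W with lookup M x in eq | lookup W x in eq′
    ... | true  | _     = contradiction (lookup⇒[]= x M eq) x∉M
    ... | false | true  = contradiction (lookup⇒[]= x W eq′) x∉W
    ... | false | false = refl

  alignment-module : IsModule (reverse T alignment alignment⊆A) M
  alignment-module x x∉M with x ∈? W
  ... | yes x∈W = inj₂ above
    where
    above : ∀ m → m ∈ M → x T′.⟶ m
    above m m∈M with m ∈? arcs T x
    ... | yes x⟶m = arc-kept T alignment alignment⊆A x⟶m λ m∈B →
      ∉⊥ (proj₂ (x∈p∩q⁻ (arcs T x) ⊥ (subst (m ∈_) (at-W x∉M x∈W) m∈B)))
    ... | no  x↛m = arc-flipped T alignment alignment⊆A (subst (x ∈_) (sym (at-M m∈M))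
      (x∈p∩q⁺ (Equivalence.from (oriented m≢x) x↛m , x∈p∩q⁺ (x∉p⇒x∈∁p x∉M , x∈W))))
      where
      m≢x : m ≢ x
      m≢x refl = x∉M m∈M
  ... | no  x∉W = inj₁ below
    where
    below : ∀ m → m ∈ M → m T′.⟶ x
    below m m∈M with x ∈? arcs T m
    ... | yes m⟶x = arc-kept T alignment alignment⊆A m⟶x λ x∈B →
      x∉W (proj₂ (x∈p∩q⁻ (∁ M) W
        (proj₂ (x∈p∩q⁻ (arcs T m) (∁ M ∩ W) (subst (x ∈_) (at-M m∈M) x∈B)))))
    ... | no  m↛x = arc-flipped T alignment alignment⊆A (subst (m ∈_) (sym (off-W x∉M x∉W))
      (x∈p∩q⁺ (Equivalence.from (oriented x≢m) m↛x , m∈M)))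
      where
      x≢m : x ≢ m
      x≢m refl = x∉M m∈M

  -- Charges every reversed arc to its end outside M: a vertex of W pays for the arcs from M, any
  -- other for its arcs into M.
  alignment-cost : ℕ
  alignment-cost = sum λ x →
    χ (∁ M) x * (χ W x * inn (adj T) (χ M) x + χ (∁ W) x * out (adj T) (χ M) x)

  size-alignment : size alignment ≡ alignment-cost
  size-alignment = begin-equality
    size alignment
      ≡⟨ size-sum alignment ⟩
    sum (λ x → sum (χ (alignment x)))
      ≡⟨ sum-cong (λ x → trans (sum-cong (row x)) (trans (sum-+ _ _) (cong₂ _+_
           (sym (sum-*ˡ (χ M x) _))
           (trans (sym (sum-*ˡ (χ (∁ M) x) _)) (cong (χ (∁ M) x *_) (sym (sum-*ˡ (χ (∁ W) x) _))))))) ⟩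
    sum (λ x → χ M x * out α κ x + χ (∁ M) x * (χ (∁ W) x * out α (χ M) x))
      -- For the rows at M the outer end is the head, so their cost is moved there by double
      -- counting.
      ≡⟨ trans (sum-+ _ _) (cong (_+ sum (λ x → χ (∁ M) x * (χ (∁ W) x * out α (χ M) x)))
           (sum-out≡sum-inn α κ (χ M))) ⟩
    sum (λ x → κ x * inn α (χ M) x) + sum (λ x → χ (∁ M) x * (χ (∁ W) x * out α (χ M) x))
      ≡⟨ sym (sum-+ _ _) ⟩
    sum (λ x → κ x * inn α (χ M) x + χ (∁ M) x * (χ (∁ W) x * out α (χ M) x))
      ≡⟨ sum-cong (λ x → factor (χ (∁ M) x) (χ W x) _ _) ⟩
    alignment-cost ∎
    where
    open ≤-Reasoning
    α = adj T
    κ : Fin n → ℕ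
    κ x = χ (∁ M) x * χ W x
    factor : ∀ g w i o → g * w * i + g * o ≡ g * (w * i + o)
    factor = solve-∀
    row : ∀ x y → χ (alignment x) y
                ≡ χ M x * (κ y * α x y) + χ (∁ M) x * (χ (∁ W) x * (χ M y * α x y))
    row x y with x ∈? M | x ∈? W
    ... | yes x∈M | _ rewrite at-M x∈M | χ-∩ (arcs T x) (∁ M ∩ W) y | χ-∩ (∁ M) W y
                            | χ-∈ x∈M | χ-∉ (∁ M) (x∈p⇒x∉∁p x∈M) = comm (α x y) (κ y)
      where
      comm : ∀ a k → a * k ≡ 1 * (k * a) + 0
      comm = solve-∀
    ... | no x∉M | yes x∈W rewrite at-W x∉M x∈W | χ-∩ (arcs T x) ⊥ y | χ-⊥ y
                                 | χ-∉ M x∉M | χ-∉ (∁ W) (x∈p⇒x∉∁p x∈W) =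
      trans (*-zeroʳ (α x y)) (sym (*-zeroʳ (χ (∁ M) x)))
    ... | no x∉M | no x∉W rewrite off-W x∉M x∉W | χ-∩ (arcs T x) M y
                                | χ-∉ M x∉M | χ-∈ (x∉p⇒x∈∁p x∉M) | χ-∈ (x∉p⇒x∈∁p x∉W) =
      comm (α x y) (χ M y)
      where
      comm : ∀ a k → a * k ≡ 1 * (1 * (k * a))
      comm = solve-∀

  break-along : ∀ {s} → 2 ≤ ∣ M ∣ → ∣ M ∣ < n → alignment-cost ≤ s → Breakable T s
  break-along 2≤∣M∣ ∣M∣<n cost≤s = record
    { flips     = alignment
    ; flips⊆A   = alignment⊆A
    ; cheap     = ≤-trans (≤-reflexive size-alignment) cost≤s
    ; nonsimple = λ simple →
        [ (λ ∣M∣≤1 → <⇒≱ 2≤∣M∣ ∣M∣≤1) , (λ ∣M∣≡n → <⇒≢ ∣M∣<n ∣M∣≡n) ]′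
        (trivial⇒∣M∣ (proj₂ simple M alignment-module))
    }

module _ {T : Tournament n} (3≤n : 3 ≤ n) where

  open ≤-Reasoning
  private
    α = adj T

    ∣∁⁅v⁆∣ : ∀ v → ∣ ∁ ⁅ v ⁆ ∣ ≡ n ∸ 1
    ∣∁⁅v⁆∣ v = trans (∣∁p∣≡n∸∣p∣ ⁅ v ⁆) (cong (n ∸_) (∣⁅x⁆∣≡1 v))

    -- The complement of v becomes a module by making v a source, if v is in W, or a sink otherwise;
    -- v is the only vertex that pays.
    break-star : ∀ v W {s} →
      χ W v * inn α (χ (∁ ⁅ v ⁆)) v + χ (∁ W) v * out α (χ (∁ ⁅ v ⁆)) v ≤ s → Breakable T s
    break-star v W cost≤s = break-along T (∁ ⁅ v ⁆) W
      (≤-trans (∸-monoˡ-≤ 1 3≤n) (≤-reflexive (sym (∣∁⁅v⁆∣ v))))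
      (≤-<-trans (≤-reflexive (∣∁⁅v⁆∣ v)) (∸-monoʳ-< {n} z<s (≤-trans (s≤s z≤n) 3≤n)))
      (≤-trans (≤-reflexive (trans (sum-cong λ x → cong (_* cost x) (χ-∁∁ x)) (sum-δ v cost))) cost≤s)
      where
      cost : Fin n → ℕ
      cost x = χ W x * inn α (χ (∁ ⁅ v ⁆)) x + χ (∁ W) x * out α (χ (∁ ⁅ v ⁆)) x
      χ-∁∁ : ∀ x → χ (∁ (∁ ⁅ v ⁆)) x ≡ δ v x
      χ-∁∁ x = +-cancelʳ-≡ (χ (∁ ⁅ v ⁆) x) _ _
        (trans (χ-∁ (∁ ⁅ v ⁆) x) (sym (trans (+-comm (δ v x) _) (χ-∁ ⁅ v ⁆ x))))

  break-out : ∀ v {s} → sum (α v) ≤ s → Breakable T s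
  break-out v d≤s = break-star v ⊥ (≤-trans (≤-reflexive
    (cong₂ (λ a b → a * inn α (χ (∁ ⁅ v ⁆)) v + b * out α (χ (∁ ⁅ v ⁆)) v)
      (χ-⊥ v) (χ-∈ (x∉p⇒x∈∁p (∉⊥ {x = v})))))
    (≤-trans (≤-reflexive (*-identityˡ _)) (≤-trans (weight≤total (∁ ⁅ v ⁆) (α v)) d≤s)))

  break-inn : ∀ v {s} → sum (λ x → α x v) ≤ s → Breakable T s
  break-inn v d≤s = break-star v ⊤ (≤-trans (≤-reflexive
    (trans (cong₂ (λ a b → a * inn α (χ (∁ ⁅ v ⁆)) v + b * out α (χ (∁ ⁅ v ⁆)) v)
      (χ-∈ (∈⊤ {x = v})) (χ-∉ (∁ ⊤) (x∈p⇒x∉∁p (∈⊤ {x = v})))) (+-identityʳ _)))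
    (≤-trans (≤-reflexive (*-identityˡ _)) (≤-trans (weight≤total (∁ ⁅ v ⁆) (λ x → α x v)) d≤s)))

  -- The pair u, v becomes a module. The vertices to repair are those, other than u and v, in
  -- exactly one of the two out-neighbourhoods: the sum of the degrees, minus twice the common
  -- out-neighbours, minus 1 for the arc between u and v.
  break-twins : ∀ {u v s} → u ≢ v →
                sum (α u) + sum (α v) ≤ s + 1 + 2 * sum (λ z → α u z * α v z) → Breakable T s
  break-twins {u} {v} {s} u≢v cost≤s = break-along T M W
    (≤-reflexive (sym ∣M∣≡2)) (≤-trans (≤-reflexive (cong suc ∣M∣≡2)) 3≤n)
    (+-cancelʳ-≤ (1 + 2 * c) _ _ (begin
      alignment-cost T M W + (1 + 2 * c)
        ≡⟨ cong (λ t → alignment-cost T M W + t) (cong₂ _+_ one (sum-*ˡ 2 _)) ⟩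
      alignment-cost T M W + (sum (λ z → δ u z * α v z + δ v z * α u z) + sum (λ z → 2 * (α u z * α v z)))
        ≡⟨ trans (cong (alignment-cost T M W +_) (sym (sum-+ _ _))) (sym (sum-+ _ _)) ⟩
      sum (λ z → χ (∁ M) z * (χ W z * inn α (χ M) z + χ (∁ W) z * out α (χ M) z)
        + (δ u z * α v z + δ v z * α u z + 2 * (α u z * α v z)))
        ≤⟨ sum-mono pointwise ⟩
      sum (λ z → α u z + α v z)
        ≡⟨ sum-+ _ _ ⟩
      sum (α u) + sum (α v)
        ≤⟨ cost≤s ⟩
      s + 1 + 2 * c
        ≡⟨ +-assoc s 1 (2 * c) ⟩
      s + (1 + 2 * c) ∎))
    where
    M W : Subset n
    M = ⁅ u ⁆ ∪ ⁅ v ⁆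
    -- Every other vertex keeps its arc with v and imitates it towards u.
    W = converse (arcs T) v
    c = sum λ z → α u z * α v z

    μ≡ : ∀ z → χ M z ≡ δ u z + δ v z
    μ≡ z with z ∈? ⁅ u ⁆ | z ∈? ⁅ v ⁆
    ... | yes z∈u | yes z∈v = contradiction
      (trans (sym (x∈⁅y⁆⇒x≡y u z∈u)) (x∈⁅y⁆⇒x≡y v z∈v)) u≢v
    ... | yes z∈u | no  z∉v rewrite χ-∈ z∈u | χ-∉ ⁅ v ⁆ z∉v = χ-∈ (x∈p∪q⁺ (inj₁ z∈u))
    ... | no  z∉u | yes z∈v rewrite χ-∉ ⁅ u ⁆ z∉u | χ-∈ z∈v = χ-∈ (x∈p∪q⁺ {p = ⁅ u ⁆} (inj₂ z∈v))
    ... | no  z∉u | no  z∉v rewrite χ-∉ ⁅ u ⁆ z∉u | χ-∉ ⁅ v ⁆ z∉v =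
      χ-∉ M λ z∈M → [ z∉u , z∉v ]′ (x∈p∪q⁻ ⁅ u ⁆ ⁅ v ⁆ z∈M)

    ∣M∣≡2 : ∣ M ∣ ≡ 2
    ∣M∣≡2 = begin-equality
      ∣ M ∣                   ≡⟨ sym (sum-χ M) ⟩
      sum (χ M)               ≡⟨ sum-cong μ≡ ⟩
      sum (λ z → δ u z + δ v z) ≡⟨ sum-+ _ _ ⟩
      sum (δ u) + sum (δ v)   ≡⟨ cong₂ _+_ (trans (sum-χ ⁅ u ⁆) (∣⁅x⁆∣≡1 u)) (trans (sum-χ ⁅ v ⁆) (∣⁅x⁆∣≡1 v)) ⟩
      2                       ∎

    weigh : ∀ f → sum (λ z → χ M z * f z) ≡ f u + f v
    weigh f = begin-equality
      sum (λ z → χ M z * f z)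
        ≡⟨ sum-cong (λ z → trans (cong (_* f z) (μ≡ z)) (*-distribʳ-+ (f z) (δ u z) (δ v z))) ⟩
      sum (λ z → δ u z * f z + δ v z * f z)
        ≡⟨ sum-+ _ _ ⟩
      sum (λ z → δ u z * f z) + sum (λ z → δ v z * f z)
        ≡⟨ cong₂ _+_ (sum-δ u f) (sum-δ v f) ⟩
      f u + f v ∎

    -- The arc between u and v, spread over z = u and z = v so that the comparison can be made
    -- vertex by vertex.
    one : 1 ≡ sum (λ z → δ u z * α v z + δ v z * α u z)
    one = begin-equality
      1                       ≡⟨ sym (adj-total T u v) ⟩
      α u v + α v u + δ u v   ≡⟨ cong (α u v + α v u +_) (δ-≢ u≢v) ⟩
      α u v + α v u + 0       ≡⟨ trans (+-identityʳ _) (+-comm (α u v) (α v u)) ⟩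
      α v u + α u v           ≡⟨ sym (cong₂ _+_ (sum-δ u (α v)) (sum-δ v (α u))) ⟩
      sum (λ z → δ u z * α v z) + sum (λ z → δ v z * α u z) ≡⟨ sym (sum-+ _ _) ⟩
      sum (λ z → δ u z * α v z + δ v z * α u z) ∎

    χW≡ : ∀ z → χ W z ≡ α z v
    χW≡ z = cong ⟦_⟧ (lookup∘tabulate _ z)

    α-opposite : ∀ {x z} → x ≢ z → α x z + α z x ≡ 1
    α-opposite {x} {z} x≢z = trans (sym (+-identityʳ _))
      (trans (cong (α x z + α z x +_) (sym (δ-≢ x≢z))) (adj-total T x z))

    -- Here a and b tell whether u and v dominate z, a′ and b′ whether z dominates them; an arc at z
    -- is reversed exactly when a ≠ b.
    separation : ∀ a a′ b b′ → a + a′ ≡ 1 → b + b′ ≡ 1 →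
                 b′ * (a + b) + b * (a′ + b′) + 2 * (a * b) ≤ a + b
    separation 0 1 0 1 refl refl = z≤n
    separation 0 1 1 0 refl refl = ≤-refl
    separation 1 0 0 1 refl refl = ≤-refl
    separation 1 0 1 0 refl refl = ≤-refl

    χ∁W≡ : ∀ {z} → v ≢ z → χ (∁ W) z ≡ α v z
    χ∁W≡ {z} v≢z = +-cancelʳ-≡ (α z v) _ _
      (trans (trans (cong (χ (∁ W) z +_) (sym (χW≡ z))) (χ-∁ W z)) (sym (α-opposite v≢z)))

    pointwise : ∀ z → χ (∁ M) z * (χ W z * inn α (χ M) z + χ (∁ W) z * out α (χ M) z)
                + (δ u z * α v z + δ v z * α u z + 2 * (α u z * α v z)) ≤ α u z + α v z
    pointwise z with u ≟ z | v ≟ z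
    ... | yes refl | yes refl = contradiction refl u≢v
    ... | yes refl | no v≢u rewrite χ-∉ (∁ M) (x∈p⇒x∉∁p (x∈p∪q⁺ {q = ⁅ v ⁆} (inj₁ (x∈⁅x⁆ u))))
                                  | δ-refl u | δ-≢ v≢u | adj-irrefl T u =
      ≤-reflexive (pad (α v u))
      where
      pad : ∀ a → 1 * a + 0 + 0 ≡ a
      pad = solve-∀
    ... | no u≢v | yes refl rewrite χ-∉ (∁ M) (x∈p⇒x∉∁p (x∈p∪q⁺ {p = ⁅ u ⁆} (inj₂ (x∈⁅x⁆ v))))
                                  | δ-refl v | δ-≢ u≢v | adj-irrefl T v =
      ≤-reflexive (pad (α u v))
      where
      pad : ∀ a → 1 * a + 2 * (a * 0) ≡ a + 0
      pad = solve-∀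
    ... | no u≢z | no v≢z rewrite δ-≢ u≢z | δ-≢ v≢z | weigh (λ y → α z y) | weigh (λ y → α y z) =
      ≤-trans (+-monoˡ-≤ (2 * (α u z * α v z)) (≤-trans
        (*-monoˡ-≤ _ (χ-≤1 (∁ M) z)) (≤-reflexive (trans (*-identityˡ _)
          (cong₂ (λ w w̄ → w * (α u z + α v z) + w̄ * (α z u + α z v)) (χW≡ z) (χ∁W≡ v≢z))))))
        (separation (α u z) (α z u) (α v z) (α z v) (α-opposite u≢z) (α-opposite v≢z))

-- In each case the arcs to be reversed include none at R, which saves one arc
-- for every vertex of R.
data Witness (T : Tournament n) (R : Subset n) : Set where
  sink   : ∀ x → (∀ {r} → r ∈ R → x ∈ arcs T r) → Witness T R
  source : ∀ x → (∀ {r} → r ∈ R → r ∈ arcs T x) → Witness T R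
  twins  : ∀ x y → x ≢ y →
           (∀ {r} → r ∈ R → (r ∈ arcs T x × y ∈ arcs T r) ⊎ (x ∈ arcs T r × r ∈ arcs T y)) →
           Witness T R

sum-outside : (R : Subset n) (f : Fin n → ℕ) →
              sum (f ∘ element (∁ R)) + sum (λ x → χ R x * f x) ≡ sum f
sum-outside R f = begin-equality
  sum (f ∘ element (∁ R)) + sum (λ x → χ R x * f x)
    ≡⟨ cong (_+ sum (λ x → χ R x * f x)) (sum-element (∁ R) f) ⟩
  sum (λ x → χ (∁ R) x * f x) + sum (λ x → χ R x * f x)
    ≡⟨ sym (sum-+ _ _) ⟩
  sum (λ x → χ (∁ R) x * f x + χ R x * f x)
    ≡⟨ sum-cong (λ x → trans (sym (*-distribʳ-+ (f x) (χ (∁ R) x) (χ R x)))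
         (trans (cong (_* f x) (χ-∁ R x)) (*-identityˡ (f x)))) ⟩
  sum f ∎
  where open ≤-Reasoning

sum-const-on : (R : Subset n) (f : Fin n → ℕ) (c : ℕ) → (∀ {r} → r ∈ R → f r ≡ c) →
               sum (λ x → χ R x * f x) ≡ ∣ R ∣ * c
sum-const-on R f c f≡c = trans
  (sum-cong λ x → ≤-antisym (χ-guard R λ x∈R → ≤-reflexive (f≡c x∈R))
                            (χ-guard R λ x∈R → ≤-reflexive (sym (f≡c x∈R))))
  (trans (sym (sum-*ʳ c (χ R))) (cong (_* c) (sum-χ R)))

module _ {k} {T : Tournament n} (reg : Regular k T) (R : Subset n) where

  open Regular reg
  open Tournament T hiding (arcs)
  open ≤-Reasoning
  private
    α = adj T
    T⁻ = remove T R

    outside-vertex : ∀ {x} → x ∉ R → ∃ λ i → element (∁ R) i ≡ x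
    outside-vertex x∉R = element-surjective (∁ R) (x∉p⇒x∈∁p x∉R)

    asym : ∀ {x y} → x ⟶ y → ¬ (y ⟶ x)
    asym {x} {y} x⟶y = Equivalence.to (oriented λ { refl → distinct x x⟶y }) x⟶y

    -- Each vertex of R takes one from the degree 2k + 1.
    reduced-degree : ∀ {h} → ∣ R ∣ + h ≡ k → (f : Fin n → ℕ) → sum f ≡ 2 * k + 1 →
                     (∀ {r} → r ∈ R → f r ≡ 1) → sum (f ∘ element (∁ R)) ≡ k + suc h
    reduced-degree {h} refl f f≡ f≡1 = +-cancelʳ-≡ ∣ R ∣ _ _ (begin-equality
      sum (f ∘ element (∁ R)) + ∣ R ∣
        ≡⟨ cong (sum (f ∘ element (∁ R)) +_) (sym (trans (sum-const-on R f 1 f≡1) (*-identityʳ ∣ R ∣))) ⟩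
      sum (f ∘ element (∁ R)) + sum (λ x → χ R x * f x)
        ≡⟨ sum-outside R f ⟩
      sum f
        ≡⟨ f≡ ⟩
      2 * (∣ R ∣ + h) + 1
        ≡⟨ split ∣ R ∣ h ⟩
      ∣ R ∣ + h + suc h + ∣ R ∣ ∎)
      where
      split : ∀ l h → 2 * (l + h) + 1 ≡ l + h + suc h + l
      split = solve-∀

  break : ∀ {h} → ∣ R ∣ + h ≡ k → 3 ≤ ∣ ∁ R ∣ → Witness T R → Breakable T⁻ (k + suc h)
  -- The constructor describes x relative to R, and the reversal exchanges the roles: x has lost |R|
  -- in-arcs, and reversing the remaining ones makes it a source of T - R. A `source` likewise
  -- becomes a sink.
  break l+h≡k 3≤N (sink x R⟶x)
    with outside-vertex (λ x∈R → distinct x (R⟶x x∈R))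
  ... | v , refl = break-inn 3≤N v (≤-reflexive (trans
    (sum-cong λ i → adj-induced T (∁ R) i v)
    (reduced-degree l+h≡k (λ y → α y x) (indegree x) λ r∈R → χ-∈ (R⟶x r∈R))))
  break l+h≡k 3≤N (source x x⟶R)
    with outside-vertex (λ x∈R → distinct x (x⟶R x∈R))
  ... | v , refl = break-out 3≤N v (≤-reflexive (trans
    (sum-cong λ i → adj-induced T (∁ R) v i)
    (reduced-degree l+h≡k (α x) (outdegree x) λ r∈R → χ-∈ (x⟶R r∈R))))
  -- Each vertex of R is an out-neighbour of exactly one of x and y, so the two degrees together
  -- drop by |R| while all k common out-neighbours survive: 2(2k + 1) - |R| - 2k - 1 reversals.
  break {h} l+h≡k 3≤N (twins x y x≢y separated)
    with outside-vertex (λ x∈R → [ distinct x ∘ proj₁ , distinct x ∘ proj₁ ]′ (separated x∈R))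
       | outside-vertex (λ y∈R → [ distinct y ∘ proj₂ , distinct y ∘ proj₂ ]′ (separated y∈R))
  ... | u , refl | v , refl = break-twins 3≤N (λ { refl → x≢y refl }) (≤-reflexive (begin-equality
    sum (adj T⁻ u) + sum (adj T⁻ v)
      ≡⟨ cong₂ _+_ (sum-cong (adj-induced T (∁ R) u)) (sum-cong (adj-induced T (∁ R) v)) ⟩
    sum (α x ∘ element (∁ R)) + sum (α y ∘ element (∁ R))
      ≡⟨ sym (sum-+ _ _) ⟩
    sum ((λ z → α x z + α y z) ∘ element (∁ R))
      ≡⟨ +-cancelʳ-≡ ∣ R ∣ _ _ degrees ⟩
    k + suc h + 1 + 2 * k
      ≡⟨ cong (λ c → k + suc h + 1 + 2 * c) (sym commons) ⟩
    k + suc h + 1 + 2 * sum ((λ z → α x z * α y z) ∘ element (∁ R))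
      ≡⟨ cong (λ c → k + suc h + 1 + 2 * c)
           (sum-cong λ i → sym (cong₂ _*_ (adj-induced T (∁ R) u i) (adj-induced T (∁ R) v i))) ⟩
    k + suc h + 1 + 2 * sum (λ i → adj T⁻ u i * adj T⁻ v i) ∎))
    where
    split : ∀ l h → 2 * (l + h) + 1 + (2 * (l + h) + 1) ≡ l + h + suc h + 1 + 2 * (l + h) + l
    split = solve-∀

    sum≡1 : ∀ {r} → r ∈ R → α x r + α y r ≡ 1
    sum≡1 r∈R with separated r∈R
    ... | inj₁ (x⟶r , r⟶y) = cong₂ _+_ (χ-∈ x⟶r) (χ-∉ (arcs T y) (asym r⟶y))
    ... | inj₂ (r⟶x , y⟶r) = cong₂ _+_ (χ-∉ (arcs T x) (asym r⟶x)) (χ-∈ y⟶r)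

    product≡0 : ∀ {r} → r ∈ R → α x r * α y r ≡ 0
    product≡0 {r} r∈R with separated r∈R
    ... | inj₁ (_ , r⟶y) = trans (cong (α x r *_) (χ-∉ (arcs T y) (asym r⟶y))) (*-zeroʳ (α x r))
    ... | inj₂ (r⟶x , _) = cong (_* α y r) (χ-∉ (arcs T x) (asym r⟶x))

    degrees : sum ((λ z → α x z + α y z) ∘ element (∁ R)) + ∣ R ∣ ≡ k + suc h + 1 + 2 * k + ∣ R ∣
    degrees = begin-equality
      sum ((λ z → α x z + α y z) ∘ element (∁ R)) + ∣ R ∣
        ≡⟨ cong (sum ((λ z → α x z + α y z) ∘ element (∁ R)) +_)
             (sym (trans (sum-const-on R _ 1 sum≡1) (*-identityʳ ∣ R ∣))) ⟩
      sum ((λ z → α x z + α y z) ∘ element (∁ R)) + sum (λ z → χ R z * (α x z + α y z))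
        ≡⟨ sum-outside R (λ z → α x z + α y z) ⟩
      sum (λ z → α x z + α y z)
        ≡⟨ trans (sum-+ _ _) (cong₂ _+_ (outdegree x) (outdegree y)) ⟩
      2 * k + 1 + (2 * k + 1)
        ≡⟨ subst (λ k → 2 * k + 1 + (2 * k + 1) ≡ k + suc h + 1 + 2 * k + ∣ R ∣) l+h≡k (split ∣ R ∣ h) ⟩
      k + suc h + 1 + 2 * k + ∣ R ∣ ∎

    commons : sum ((λ z → α x z * α y z) ∘ element (∁ R)) ≡ k
    commons = begin-equality
      sum ((λ z → α x z * α y z) ∘ element (∁ R))
        ≡⟨ sym (+-identityʳ _) ⟩
      sum ((λ z → α x z * α y z) ∘ element (∁ R)) + 0
        ≡⟨ cong (sum ((λ z → α x z * α y z) ∘ element (∁ R)) +_)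
             (sym (trans (sum-const-on R _ 0 product≡0) (*-zeroʳ ∣ R ∣))) ⟩
      sum ((λ z → α x z * α y z) ∘ element (∁ R)) + sum (λ z → χ R z * (α x z * α y z))
        ≡⟨ sum-outside R (λ z → α x z * α y z) ⟩
      sum (λ z → α x z * α y z)
        ≡⟨ common x≢y ⟩
      k ∎

-- Existence of suitable vertices for one, two or three removed vertices

enumerate : (R : Subset n) {l : ℕ} → ∣ R ∣ ≡ l → ∃ λ (e : Fin l → Fin n) →
            (∀ {i j} → e i ≡ e j → i ≡ j) × (∀ i → e i ∈ R) × (∀ {r} → r ∈ R → ∃ λ i → e i ≡ r)
enumerate R refl = element R , element-injective R , element-∈ R , element-surjective R

every : {R : Subset n} {l : ℕ} {e : Fin l → Fin n} {P : Fin n → Set} →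
        (∀ {r} → r ∈ R → ∃ λ i → e i ≡ r) → (∀ i → P (e i)) → ∀ {r} → r ∈ R → P r
every {P = P} onto Pe r∈R = let i , eq = onto r∈R in subst P eq (Pe i)

module _ {k} {T : Tournament n} (reg : Regular k T) (R : Subset n) where

  open Regular reg
  open Tournament T hiding (arcs)
  open ≤-Reasoning
  private
    α = adj T

    split-product : ∀ {S U : Subset n} {z} → 0 < χ S z * χ U z → z ∈ S × z ∈ U
    split-product {S} {U} {z} lt with z ∈? S | z ∈? U
    ... | yes z∈S | yes z∈U = z∈S , z∈U
    ... | no z∉S  | _ rewrite χ-∉ S z∉S = contradiction lt λ ()
    ... | yes _   | no z∉U rewrite χ-∉ U z∉U | *-zeroʳ (χ S z) = contradiction lt λ ()

    χ≡0⇒∉ : ∀ {S : Subset n} {x} → χ S x ≡ 0 → x ∉ S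
    χ≡0⇒∉ χ≡0 x∈S = contradiction (trans (sym (χ-∈ x∈S)) χ≡0) λ ()

    orient : ∀ {x y} → x ≢ y → ¬ (x ⟶ y) → y ⟶ x
    orient x≢y x↛y = Equivalence.from (oriented (x≢y ∘ sym)) x↛y

    sum-0 : sum {n} (λ _ → 0) ≡ 0
    sum-0 = sum-zero λ _ → refl

  find₁ : ∣ R ∣ ≡ 1 → Witness T R
  find₁ ∣R∣≡1 with enumerate R ∣R∣≡1
  ... | e , _ , _ , onto
    with sum-<⇒∃< (λ _ → 0) (α (e zero)) (begin-strict
      sum {n} (λ _ → 0) ≡⟨ sum-0 ⟩
      0                 <⟨ m≤n+m 1 (2 * k) ⟩
      2 * k + 1         ≡⟨ sym (outdegree (e zero)) ⟩
      sum (α (e zero))  ∎)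
  ... | x , lt = sink x (every onto λ { zero → χ-<⇒∈ (arcs T (e zero)) lt })

  -- The two elements of R have k > 0 common out-neighbours, each of which is dominated by R.
  find₂ : 2 ≤ k → ∣ R ∣ ≡ 2 → Witness T R
  find₂ 2≤k ∣R∣≡2 with enumerate R ∣R∣≡2
  ... | e , inj , _ , onto
    with sum-<⇒∃< (λ _ → 0) (λ z → α (e zero) z * α (e (suc zero)) z) (begin-strict
      sum {n} (λ _ → 0)                            ≡⟨ sum-0 ⟩
      0                                            <⟨ ≤-trans (s≤s z≤n) 2≤k ⟩
      k                                            ≡⟨ sym (common λ eq → contradiction (inj eq) λ ()) ⟩
      sum (λ z → α (e zero) z * α (e (suc zero)) z) ∎)
  ... | x , lt with split-product {arcs T (e zero)} lt
  ...   | a⟶x , b⟶x = sink x (every onto λ { zero → a⟶x ; (suc zero) → b⟶x })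

  -- A common out-neighbour of a and b dominated by c is a sink, and a common
  -- in-neighbour dominating c is a source; otherwise the two are separated by
  -- each of a, b and c.
  find₃ : 3 ≤ k → ∣ R ∣ ≡ 3 → Witness T R
  find₃ 3≤k ∣R∣≡3 with enumerate R ∣R∣≡3
  ... | e , inj , e∈R , onto = witness
    where
    a = e zero
    b = e (suc zero)
    c = e (suc (suc zero))

    a≢b : a ≢ b
    a≢b eq = contradiction (inj eq) λ ()

    -- There are k > 1 common out-neighbours of a and b, so one of them is not c; the comparison
    -- with `δ c` yields both facts at once.
    outer : ∃ λ y → δ c y < α a y * α b y
    outer = sum-<⇒∃< (δ c) _ (begin-strict
      sum (δ c)                 ≡⟨ trans (sum-χ ⁅ c ⁆) (∣⁅x⁆∣≡1 c) ⟩
      1                         <⟨ ≤-trans (n≤1+n 2) 3≤k ⟩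
      k                         ≡⟨ sym (common a≢b) ⟩
      sum (λ z → α a z * α b z) ∎)

    -- By inclusion-exclusion at least 4k + 3 - 3 - 2(2k + 1) + k = k - 2 ≥ 1 vertices lie outside R
    -- and are dominated by neither a nor b.
    inner : ∃ λ x → χ R x + α a x + α b x < 1 + α a x * α b x
    inner = sum-<⇒∃< _ _ (begin-strict
      sum (λ x → χ R x + α a x + α b x)
        ≡⟨ trans (sum-+ _ _) (cong (_+ sum (α b)) (sum-+ _ _)) ⟩
      sum (χ R) + sum (α a) + sum (α b)
        ≡⟨ cong₂ _+_ (cong₂ _+_ (trans (sum-χ R) ∣R∣≡3) (outdegree a)) (outdegree b) ⟩
      3 + (2 * k + 1) + (2 * k + 1)
        <⟨ n<1+n _ ⟩
      suc (3 + (2 * k + 1) + (2 * k + 1))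
        ≡⟨ regroup k ⟩
      4 * k + 3 + 3
        ≤⟨ +-monoʳ-≤ (4 * k + 3) 3≤k ⟩
      4 * k + 3 + k
        ≡⟨ cong₂ _+_ (sym (trans (trans (sum-const n 1) (*-identityʳ n)) order)) (sym (common a≢b)) ⟩
      sum {n} (λ _ → 1) + sum (λ x → α a x * α b x)
        ≡⟨ sym (sum-+ _ _) ⟩
      sum (λ x → 1 + α a x * α b x) ∎)
      where
      regroup : ∀ k → suc (3 + (2 * k + 1) + (2 * k + 1)) ≡ 4 * k + 3 + 3
      regroup = solve-∀

    -- For indicators, pq is at most p and at most q, so r + p + q ≤ pq forces r + q = 0 and r + p =
    -- 0.
    outsider : ∀ {x} → χ R x + α a x + α b x < 1 + α a x * α b x → x ∉ R × ¬ (a ⟶ x) × ¬ (b ⟶ x)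
    outsider {x} lt =
        χ≡0⇒∉ (m+n≡0⇒m≡0 (χ R x) r+q≡0) , χ≡0⇒∉ (m+n≡0⇒n≡0 (χ R x) r+p≡0)
      , χ≡0⇒∉ (m+n≡0⇒n≡0 (χ R x) r+q≡0)
      where
      r = χ R x
      p = α a x
      q = α b x
      swap : ∀ r p q → r + q + p ≡ r + p + q
      swap = solve-∀
      r+q≡0 : r + q ≡ 0
      r+q≡0 = n≤0⇒n≡0 (+-cancelʳ-≤ p _ _ (begin
        r + q + p ≡⟨ swap r p q ⟩
        r + p + q ≤⟨ s≤s⁻¹ lt ⟩
        p * q     ≤⟨ *-monoʳ-≤ p (χ-≤1 (arcs T b) x) ⟩
        p * 1     ≡⟨ *-identityʳ p ⟩
        p         ∎))
      r+p≡0 : r + p ≡ 0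
      r+p≡0 = n≤0⇒n≡0 (+-cancelʳ-≤ q _ _ (begin
        r + p + q ≤⟨ s≤s⁻¹ lt ⟩
        p * q     ≤⟨ *-monoˡ-≤ q (χ-≤1 (arcs T a) x) ⟩
        1 * q     ≡⟨ *-identityˡ q ⟩
        q         ∎))

    witness : Witness T R
    witness with outer | inner
    ... | y , lt | x , lt′
      with split-product {arcs T a} (≤-<-trans z≤n lt) | outsider lt′ | c ∈? arcs T x | y ∈? arcs T c
    ... | a⟶y , b⟶y | x∉R , a↛x , b↛x | c?x | c?y = decide c?x c?y
      where
      e≢x : ∀ i → e i ≢ x
      e≢x i eq = x∉R (subst (_∈ R) eq (e∈R i))
      x⟶a : x ⟶ a
      x⟶a = orient (e≢x _) a↛x
      x⟶b : x ⟶ b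
      x⟶b = orient (e≢x _) b↛x
      c≢y : c ≢ y
      -- At y = c the value of `δ c` is 1, which a product of two indicators cannot exceed.
      c≢y eq = <⇒≱ lt (subst (λ d → α a y * α b y ≤ d) (sym (trans (cong (λ c → δ c y) eq) (δ-refl y)))
        (*-mono-≤ (χ-≤1 (arcs T a) y) (χ-≤1 (arcs T b) y)))
      x≢y : x ≢ y
      x≢y refl = a↛x a⟶y
      decide : Dec (x ⟶ c) → Dec (c ⟶ y) → Witness T R
      decide (yes x⟶c) _ = source x (every onto λ
        { zero → x⟶a ; (suc zero) → x⟶b ; (suc (suc zero)) → x⟶c })
      decide _ (yes c⟶y) = sink y (every onto λ
        { zero → a⟶y ; (suc zero) → b⟶y ; (suc (suc zero)) → c⟶y })
      decide (no x↛c) (no c↛y) = twins x y x≢y (every {P = λ r → (x ⟶ r × r ⟶ y) ⊎ (r ⟶ x × y ⟶ r)} onto λ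
        { zero → inj₁ (x⟶a , a⟶y)
        ; (suc zero) → inj₁ (x⟶b , b⟶y)
        ; (suc (suc zero)) → inj₂ (orient (e≢x _ ∘ sym) x↛c , orient c≢y c↛y) })

  find : ∀ {l} → 1 ≤ l → l ≤ 3 → l ≤ k → ∣ R ∣ ≡ l → Witness T R
  find {1} _ _ _   ∣R∣≡l = find₁ ∣R∣≡l
  find {2} _ _ 2≤k ∣R∣≡l = find₂ 2≤k ∣R∣≡l
  find {3} _ _ 3≤k ∣R∣≡l = find₃ 3≤k ∣R∣≡l
  find {suc (suc (suc (suc _)))} _ (s≤s (s≤s (s≤s ()))) _ _

theorem1p2 : (l k : ℕ) → 1 ≤ l → l ≤ 3 → l ≤ k →
    (T : Tournament (4 * k + 3)) → DoublyRegular T →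
    (R : Subset (4 * k + 3)) → ∣ R ∣ ≡ l →
    IsSimplicityIndex (remove T R) ((2 * k + 1) ∸ l)
theorem1p2 l k 1≤l l≤3 l≤k T T-doublyRegular R refl = subst (IsSimplicityIndex (remove T R)) s≡ record
  { order≥3  = 3≤N
  -- The construction reverses at most `k + suc h` arcs, and the lower bound applied to the same
  -- arcs gives equality.
  ; attained = flips , flips⊆A , ≤-antisym cheap (lower flips flips⊆A nonsimple) , nonsimple
  ; minimal  = lower
  }
  where
  h = k ∸ l
  l+h≡k : l + h ≡ k
  l+h≡k = m+[n∸m]≡n l≤k
  reg = doublyRegular⇒Regular k T T-doublyRegular

  s≡ : k + suc h ≡ 2 * k + 1 ∸ l
  s≡ = sym (trans (cong (_∸ l) (split k l h l+h≡k)) (m+n∸m≡n l (k + suc h)))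
    where
    split : ∀ k l h → l + h ≡ k → 2 * k + 1 ≡ l + (k + suc h)
    split _ l h refl = regroup l h
      where
      regroup : ∀ l h → 2 * (l + h) + 1 ≡ l + (l + h + suc h)
      regroup = solve-∀

  -- Since l ≤ k ≤ 4k, at least three of the 4k + 3 vertices remain.
  3≤N : 3 ≤ ∣ ∁ R ∣
  3≤N = subst (3 ≤_) (sym (∣∁p∣≡n∸∣p∣ R)) (m+n≤o⇒m≤o∸n 3 (≤-trans
    (≤-reflexive (+-comm 3 l)) (+-monoˡ-≤ 3 (≤-trans l≤k (m≤m+n k (3 * k))))))

  lower = minimal-cost reg R l+h≡k 3≤N

  open Breakable (break reg R l+h≡k 3≤N (find reg R 1≤l l≤3 l≤k refl))
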